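{- For every positive integer $n$, $$\sum_{\ell(\lambda)\le n}\binom{n}{m_0(\lambda),m_1(\lambda),\dots}\prod_{i=1}^n q_i^{\lambda_i}=\frac{\sum_{\sigma\in B_n}\prod_{i=1}^n q_i^{d_i(\sigma)+n_i(\sigma^{ -1})}}{\prod_{i=1}^n(1-q_1^2\cdots q_i^2)}$$ in $\mathbf{Z}[[q_1,\dots,q_n]]$, where the sum on the left is over all partitions $\lambda=(\lambda_1,\dots,\lambda_n)$ with at most $n$ nonzero parts.
   Context: For a partition $\lambda=(\lambda_1\ge\dots\ge\lambda_n\ge0)$, $m_j(\lambda)=|\{1\le i\le n:\lambda_i=j\}|$, and the coefficient is the multinomial coefficient. $B_n$ is the group of signed permutations of $[-n,n]\setminus\{0\}$. For $\sigma\in B_n$: ${\it Des}(\sigma)=\{i\in[n-1]:\sigma(i)>\sigma(i+1)\}$, $d_i(\sigma)=|\{j\in{\it Des}(\sigma):j\ge i\}|$, ${\it Neg}(\sigma)=\{i\in[n]:\sigma(i)<0\}$, $n_i(\sigma)=|\{j\in{\it Neg}(\sigma):j\ge i\}|$. -}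

module Defs where

open import Data.Nat as ℕ using (ℕ; zero; suc; _+_; _*_; _∸_; _≡ᵇ_; _≤ᵇ_; _<ᵇ_; _⊔_)
open import Data.Nat.Combinatorics using (_C_)
open import Data.Integer as ℤ using (ℤ; +_; -[1+_]; ∣_∣)
open import Data.Bool using (Bool; true; false; if_then_else_; _∧_; not)
open import Data.List as List using (List; []; _∷_; _++_; map; concatMap; upTo; length; foldr) renaming (filterᵇ to filter)
open import Data.Nat.ListAction using (sum)
open import Data.Bool.ListAction using (any)
open import Data.Vec as Vec using (Vec; []; _∷_; tabulate; lookup; toList; zipWith)
open import Data.Vec.Properties using (≡-dec)
open import Data.Fin using (Fin; toℕ)
open import Relation.Nullary.Decidable using (⌊_⌋)

-- Formal power series in n variables q_1..q_n with integer coefficients.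
-- An exponent vector a : Vec ℕ n stands for the monomial q_1^{a_1}⋯q_n^{a_n};
-- a series is its coefficient function.

Exp : ℕ → Set
Exp n = Vec ℕ n

FPS : ℕ → Set
FPS n = Exp n → ℤ

_≟ₑ_ : ∀ {n} → Exp n → Exp n → Bool
a ≟ₑ b = ⌊ ≡-dec ℕ._≟_ a b ⌋

below : ∀ {n} → Exp n → List (Exp n)
below []       = [] ∷ []
below (x ∷ xs) = concatMap (λ i → map (i ∷_) (below xs)) (upTo (suc x))

sumℤ : List ℤ → ℤ
sumℤ = foldr ℤ._+_ (+ 0)

_⋆_ : ∀ {n} → FPS n → FPS n → FPS n
(f ⋆ g) a = sumℤ (map (λ b → f b ℤ.* g (zipWith _∸_ a b)) (below a))

one : ∀ {n} → FPS n
one {n} a = if a ≟ₑ Vec.replicate n 0 then + 1 else + 0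

-- geometric series  1/(1 - q^e) = Σ_{k≥0} q^{k e},  for a NONZERO exponent
-- vector e.  For e ≠ 0, k e = a forces k ≤ Σ a, so the coefficient of q^a
-- is the number of k ≤ Σ a with k e = a.
geom : ∀ {n} → Exp n → FPS n
geom e a = + length (filter (λ k → (Vec.map (k *_) e) ≟ₑ a)
                            (upTo (suc (sum (toList a)))))

weaklyDecreasing : List ℕ → Bool
weaklyDecreasing (x ∷ y ∷ r) = (y ≤ᵇ x) ∧ weaklyDecreasing (y ∷ r)
weaklyDecreasing _           = true

mult : List ℕ → ℕ → ℕ
mult l j = length (filter (λ x → x ≡ᵇ j) l)

multinomial : List ℕ → ℕ
multinomial []       = 1
multinomial (k ∷ ks) = ((k + sum ks) C k) * multinomial ks

-- the sequence (m_0(λ), m_1(λ), …, m_{λ_1}(λ)); all later m_j vanish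
multiplicities : List ℕ → List ℕ
multiplicities l = map (mult l) (upTo (suc (foldr _⊔_ 0 l)))

lhs : (n : ℕ) → FPS n
lhs n a = if weaklyDecreasing (toList a)
          then + multinomial (multiplicities (toList a))
          else + 0

-- Signed permutations B_n, as the vector (σ(1), …, σ(n)).

signedVals : ℕ → List ℤ
signedVals n = map (λ k → + suc k) (upTo n) ++ map -[1+_] (upTo n)

vecsOver : ∀ {A : Set} → List A → (m : ℕ) → List (Vec A m)
vecsOver xs zero    = [] ∷ []
vecsOver xs (suc m) = concatMap (λ x → map (x ∷_) (vecsOver xs m)) xs

allDistinct : List ℕ → Bool
allDistinct []      = true
allDistinct (x ∷ r) = not (any (λ y → x ≡ᵇ y) r) ∧ allDistinct r

Bn : (n : ℕ) → List (Vec ℤ n)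
Bn n = filter (λ σ → allDistinct (map ∣_∣ (toList σ))) (vecsOver (signedVals n) n)

-- sign-preserving product (sign of x) * m, for x ≠ 0
signTimes : ℤ → ℕ → ℤ
signTimes (+ _)    m = + m
signTimes -[1+ _ ] m = ℤ.- (+ m)

invAt : List ℤ → ℕ → ℕ → ℤ
invAt []      pos j = + 0
invAt (x ∷ r) pos j = if ∣ x ∣ ≡ᵇ j then signTimes x pos else invAt r (suc pos) j

inverse : ∀ {n} → Vec ℤ n → Vec ℤ n
inverse {n} σ = tabulate (λ (j : Fin n) → invAt (toList σ) 1 (suc (toℕ j)))

desFrom : List ℤ → ℕ → List ℕ
desFrom (x ∷ y ∷ r) i = (if ⌊ y ℤ.<? x ⌋ then i ∷ desFrom (y ∷ r) (suc i) else desFrom (y ∷ r) (suc i))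
desFrom _           i = []

Des : ∀ {n} → Vec ℤ n → List ℕ
Des σ = desFrom (toList σ) 1

negFrom : List ℤ → ℕ → List ℕ
negFrom []      i = []
negFrom (x ∷ r) i = if ⌊ x ℤ.<? + 0 ⌋ then i ∷ negFrom r (suc i) else negFrom r (suc i)

Neg : ∀ {n} → Vec ℤ n → List ℕ
Neg σ = negFrom (toList σ) 1

countGe : ℕ → List ℕ → ℕ
countGe i S = length (filter (λ j → i ≤ᵇ j) S)

d : ∀ {n} → Vec ℤ n → ℕ → ℕ
d σ i = countGe i (Des σ)

nn : ∀ {n} → Vec ℤ n → ℕ → ℕ
nn σ i = countGe i (Neg σ)

sigmaExp : ∀ {n} → Vec ℤ n → Exp n
sigmaExp {n} σ = tabulate (λ (i : Fin n) → d σ (suc (toℕ i)) + nn (inverse σ) (suc (toℕ i)))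

numerator : (n : ℕ) → FPS n
numerator n a = + length (filter (λ σ → sigmaExp σ ≟ₑ a) (Bn n))

sqPrefix : (n i : ℕ) → Exp n
sqPrefix n i = tabulate (λ (j : Fin n) → if toℕ j <ᵇ i then 2 else 0)

rhs : (n : ℕ) → FPS n
rhs n = foldr (λ i f → f ⋆ geom (sqPrefix n (suc i))) (numerator n) (upTo n)

{-# OPTIONS --safe #-}

-- In the variables tᵢ = q₁⋯qᵢ the monomial q^λ of a partition becomes t^c with
-- cᵢ = λᵢ − λᵢ₊₁, and σ ∈ Bₙ contributes ∏_{i ∈ Des σ} tᵢ · ∏_{j ∈ Neg σ⁻¹} tⱼ to
-- the numerator.  Fix S = Neg σ⁻¹: then σ runs over the orderings of the n
-- integers ±1, …, ±n with signs given by S, and the number of orderings with a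
-- given descent set does not depend on S.  So the signs can be summed first,
-- and ∏ (1 + tᵢ) / (1 − tᵢ²) = ∏ 1 / (1 − tᵢ): the coefficient of t^c is the
-- number of orderings of an n-set whose descents lie in the support of c.
-- Building such an ordering letter by letter, each increasing run is a subset,
-- by the hockey-stick identity, so this number is the multinomial coefficient
-- of the gaps of the support, which are the multiplicities of the parts of λ.

module Submission where

open import Defs
open import Data.Bool using (Bool; true; false; if_then_else_; _∧_; not; T; T?)
import Data.Bool.Properties as Bool
open import Data.Bool.ListAction using (any)
open import Data.Empty using (⊥-elim)
open import Data.Fin as Fin using (Fin; toℕ; fromℕ<)
open import Data.Fin.Properties using (toℕ-fromℕ<; toℕ<n)
open import Data.Integer as ℤ using (ℤ; -[1+_]; ∣_∣)
import Data.Integer.Properties as ℤₚ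
open import Data.List as List using (List; []; _∷_; _++_; map; concatMap; upTo; length; foldr; filter; filterᵇ)
open import Data.List.Properties using (map-cong; foldr-map; filter-all; map-∘; map-++; map-upTo; upTo-∷ʳ; length-upTo; length-map; length-++)
open import Data.List.Membership.Propositional using (_∈_; _∉_)
open import Data.List.Membership.Propositional.Properties
open import Data.List.Relation.Binary.Permutation.Propositional using (_↭_; refl; prep; ↭-sym; ↭-trans)
open import Data.List.Relation.Binary.Permutation.Propositional.Properties using (shift; ∈-resp-↭) renaming (map⁺ to ↭-map⁺)
open import Data.List.Relation.Unary.All as All using (All; []; _∷_; all?)
import Data.List.Relation.Unary.All.Properties as Allₚ
open import Data.List.Relation.Unary.AllPairs using ([]; _∷_)
open import Data.List.Relation.Unary.Any using (here; there)
open import Data.List.Relation.Unary.Unique.Propositional using (Unique)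
import Data.List.Relation.Unary.Unique.Propositional.Properties as Uniqueₚ
open import Data.List.Relation.Unary.Unique.DecPropositional ℤ._≟_ using (unique?)
open import Data.Nat
open import Data.Nat.Combinatorics
open import Data.Nat.Divisibility using (_∣_)
open import Data.Nat.DivMod using (m/n*n≡m)
open import Data.Nat.ListAction using (sum; product)
open import Data.Nat.ListAction.Properties using (sum-++; sum-↭)
open import Data.Nat.Properties
open import Data.Nat.Tactic.RingSolver using (solve-∀)
open import Algebra.Properties.CommutativeSemigroup +-commutativeSemigroup using (interchange)
open import Data.Product using (∃; _×_; _,_; proj₂)
open import Data.Sum using (inj₁; inj₂)
open import Data.Vec as Vec using (Vec; []; _∷_; tabulate; toList; zipWith)
open import Data.Vec.Properties as Vecₚ using (≡-dec; lookup-map; lookup∘tabulate; tabulate∘lookup; length-toList)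
open import Function using (_∘_; id; Equivalence)
open import Relation.Binary.Definitions using (tri<; tri≈; tri>)
open import Relation.Binary.PropositionalEquality
open import Relation.Nullary using (¬_; Dec; yes; no; does; ¬?; contradiction)
open import Relation.Nullary.Decidable using (⌊_⌋; dec-true; dec-false)
open import Level using (0ℓ)
open import Relation.Unary using (Pred; Decidable)
open ≡-Reasoning

-- For a target exponent of total degree N every geometric series may be cut off at k ≤ N. The right
-- side then becomes a finite count, and the argument runs in ℕ by exchanging finite sums of
-- Kronecker deltas; ℤ survives only at the boundary. Passing to the coordinates c is additive and
-- injective on exponents, and its image is exactly the partitions, so exponents that are not weakly
-- decreasing are never reached on the right. That the descent count does not depend on S is shown
-- without a bijection between orderings. A word is read letter by letter, and each letter is
-- recorded by the number of available letters above it; a descent is then a comparison of two such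
-- ranks, and the values themselves drop out of the recursion. Signs occupy all of 1, ..., n but
-- descents only 1, ..., n - 1: the last run of an ordering ends at n whether or not λₙ = 0.

private variable
  A B : Set
  n : ℕ

-- Finite sums of natural numbers

∑ : List A → (A → ℕ) → ℕ
∑ xs f = sum (map f xs)

syntax ∑ xs (λ x → e) = ∑[ x ∈ xs ] e

⟦_⟧ : Bool → ℕ
⟦ true ⟧  = 1
⟦ false ⟧ = 0

⟦∧⟧ : ∀ a b → ⟦ a ∧ b ⟧ ≡ ⟦ a ⟧ * ⟦ b ⟧
⟦∧⟧ true  b = sym (+-identityʳ _)
⟦∧⟧ false b = refl

∑-cong : ∀ (xs : List A) {f g : A → ℕ} → (∀ x → f x ≡ g x) → ∑ xs f ≡ ∑ xs g
∑-cong xs f≗g = cong sum (map-cong f≗g xs)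

∑-cong-∈ : ∀ (xs : List A) {f g : A → ℕ} → (∀ {x} → x ∈ xs → f x ≡ g x) → ∑ xs f ≡ ∑ xs g
∑-cong-∈ []       eq = refl
∑-cong-∈ (x ∷ xs) eq = cong₂ _+_ (eq (here refl)) (∑-cong-∈ xs (eq ∘ there))

∑-zero : ∀ (xs : List A) → ∑[ x ∈ xs ] 0 ≡ 0
∑-zero []       = refl
∑-zero (x ∷ xs) = ∑-zero xs

∑-+ : ∀ (xs : List A) (f g : A → ℕ) → ∑[ x ∈ xs ] (f x + g x) ≡ ∑ xs f + ∑ xs g
∑-+ []       f g = refl
∑-+ (x ∷ xs) f g = trans (cong (f x + g x +_) (∑-+ xs f g)) (interchange (f x) (g x) _ _)

∑-*ˡ : ∀ (xs : List A) c (f : A → ℕ) → ∑[ x ∈ xs ] (c * f x) ≡ c * ∑ xs f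
∑-*ˡ []       c f = sym (*-zeroʳ c)
∑-*ˡ (x ∷ xs) c f = trans (cong (c * f x +_) (∑-*ˡ xs c f)) (sym (*-distribˡ-+ c (f x) _))

∑-*ʳ : ∀ (xs : List A) (f : A → ℕ) c → ∑[ x ∈ xs ] (f x * c) ≡ ∑ xs f * c
∑-*ʳ xs f c = trans (∑-cong xs (λ x → *-comm (f x) c)) (trans (∑-*ˡ xs c f) (*-comm c _))

∑-const : ∀ (xs : List A) c → ∑[ x ∈ xs ] c ≡ length xs * c
∑-const []       c = refl
∑-const (x ∷ xs) c = cong (c +_) (∑-const xs c)

∑-swap : ∀ (xs : List A) (ys : List B) (f : A → B → ℕ) →
         ∑[ x ∈ xs ] ∑[ y ∈ ys ] f x y ≡ ∑[ y ∈ ys ] ∑[ x ∈ xs ] f x y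
∑-swap []       ys f = sym (∑-zero ys)
∑-swap (x ∷ xs) ys f =
  trans (cong (∑ ys (f x) +_) (∑-swap xs ys f)) (sym (∑-+ ys (f x) _))

∑-++ : ∀ (xs ys : List A) (f : A → ℕ) → ∑ (xs ++ ys) f ≡ ∑ xs f + ∑ ys f
∑-++ xs ys f = trans (cong sum (map-++ f xs ys)) (sum-++ (map f xs) _)

∑-map : ∀ (xs : List A) (g : A → B) (f : B → ℕ) → ∑ (map g xs) f ≡ ∑[ x ∈ xs ] f (g x)
∑-map xs g f = cong sum (sym (map-∘ xs))

∑-concatMap : ∀ (xs : List A) (g : A → List B) (f : B → ℕ) →
              ∑ (concatMap g xs) f ≡ ∑[ x ∈ xs ] ∑ (g x) f
∑-concatMap []       g f = refl
∑-concatMap (x ∷ xs) g f = trans (∑-++ (g x) _ f) (cong (∑ (g x) f +_) (∑-concatMap xs g f))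

∑-↭ : ∀ {xs ys : List A} (f : A → ℕ) → xs ↭ ys → ∑ xs f ≡ ∑ ys f
∑-↭ f p = sum-↭ (↭-map⁺ f p)

length-filterᵇ : ∀ (p : A → Bool) xs → length (filterᵇ p xs) ≡ ∑[ x ∈ xs ] ⟦ p x ⟧
length-filterᵇ p []       = refl
length-filterᵇ p (x ∷ xs) with p x
... | true  = cong suc (length-filterᵇ p xs)
... | false = length-filterᵇ p xs

length-filter : ∀ {P : Pred A 0ℓ} (P? : Decidable P) xs → length (filter P? xs) ≡ ∑[ x ∈ xs ] ⟦ does (P? x) ⟧
length-filter P? []       = refl
length-filter P? (x ∷ xs) with does (P? x)
... | true  = cong suc (length-filter P? xs)
... | false = length-filter P? xs

∑-filter : ∀ {P : Pred A 0ℓ} (P? : Decidable P) xs (f : A → ℕ) →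
           ∑ (filter P? xs) f ≡ ∑[ x ∈ xs ] (⟦ does (P? x) ⟧ * f x)
∑-filter P? []       f = refl
∑-filter P? (x ∷ xs) f with does (P? x)
... | true  = cong₂ _+_ (sym (+-identityʳ _)) (∑-filter P? xs f)
... | false = ∑-filter P? xs f

∑-filterᵇ : ∀ (p : A → Bool) xs (f : A → ℕ) → ∑ (filterᵇ p xs) f ≡ ∑[ x ∈ xs ] (⟦ p x ⟧ * f x)
∑-filterᵇ p []       f = refl
∑-filterᵇ p (x ∷ xs) f with p x
... | true  = cong₂ _+_ (sym (+-identityʳ _)) (∑-filterᵇ p xs f)
... | false = ∑-filterᵇ p xs f

upTo-suc : ∀ m → upTo (suc m) ≡ 0 ∷ map suc (upTo m)
upTo-suc m = cong (0 ∷_) (sym (map-upTo suc m))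

∑-upTo-suc : ∀ m (f : ℕ → ℕ) → ∑ (upTo (suc m)) f ≡ f 0 + ∑[ i ∈ upTo m ] f (suc i)
∑-upTo-suc m f = trans (cong (λ l → ∑ l f) (upTo-suc m)) (cong (f 0 +_) (∑-map (upTo m) suc f))

∑-upTo-last : ∀ m (f : ℕ → ℕ) → ∑ (upTo (suc m)) f ≡ ∑ (upTo m) f + f m
∑-upTo-last m f =
  trans (cong (λ l → ∑ l f) (sym (upTo-∷ʳ m)))
        (trans (∑-++ (upTo m) _ f) (cong (∑ (upTo m) f +_) (+-identityʳ _)))

∑-upTo-truncate : ∀ {m m′} (f : ℕ → ℕ) → m ≤ m′ → (∀ {i} → m ≤ i → f i ≡ 0) → ∑ (upTo m′) f ≡ ∑ (upTo m) f
∑-upTo-truncate {m} {m′} f m≤m′ vanish = go (≤⇒≤′ m≤m′)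
  where
  go : ∀ {m′} → m ≤′ m′ → ∑ (upTo m′) f ≡ ∑ (upTo m) f
  go ≤′-refl = refl
  go (≤′-step {k} m≤k) =
    trans (∑-upTo-last k f) (trans (cong₂ _+_ (go m≤k) (vanish (≤′⇒≤ m≤k))) (+-identityʳ _))

-- Exponent vectors and Kronecker deltas

infixl 6 _⊕_

_⊕_ : Exp n → Exp n → Exp n
_⊕_ = zipWith _+_

_·_ : ℕ → Exp n → Exp n
k · e = Vec.map (k *_) e

δ₁ : ℕ → ℕ → ℕ
δ₁ x y = ⟦ x ≡ᵇ y ⟧

-- A product over coordinates, unlike the decision `≟ₑ`, so that sums over exponents factor.
δ : Exp n → Exp n → ℕ
δ []       []       = 1
δ (x ∷ xs) (y ∷ ys) = δ₁ x y * δ xs ys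

δ₁-refl : ∀ x → δ₁ x x ≡ 1
δ₁-refl zero    = refl
δ₁-refl (suc x) = δ₁-refl x

δ₁-≢ : ∀ {x y} → x ≢ y → δ₁ x y ≡ 0
δ₁-≢ {zero}  {zero}  ne = contradiction refl ne
δ₁-≢ {zero}  {suc y} ne = refl
δ₁-≢ {suc x} {zero}  ne = refl
δ₁-≢ {suc x} {suc y} ne = δ₁-≢ (ne ∘ cong suc)

δ-refl : ∀ (x : Exp n) → δ x x ≡ 1
δ-refl []       = refl
δ-refl (x ∷ xs) rewrite δ₁-refl x | δ-refl xs = refl

δ-≢ : ∀ {x y : Exp n} → x ≢ y → δ x y ≡ 0
δ-≢ {x = []}     {[]}     ne = contradiction refl ne
δ-≢ {x = x ∷ xs} {y ∷ ys} ne with x ≟ y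
... | no x≢y   rewrite δ₁-≢ x≢y = refl
... | yes refl rewrite δ-≢ {x = xs} {ys} (ne ∘ cong (x ∷_)) = *-zeroʳ (δ₁ x x)

⟦≟ₑ⟧ : ∀ (x y : Exp n) → ⟦ x ≟ₑ y ⟧ ≡ δ x y
⟦≟ₑ⟧ x y with ≡-dec _≟_ x y
... | yes refl = sym (δ-refl x)
... | no x≢y   = sym (δ-≢ x≢y)

total : Exp n → ℕ
total a = sum (toList a)

-- Convolution: a pair (b, a ∸ b) with b ≤ a matches (x, y) exactly once if x + y = a.

∑-below-∷ : ∀ x (xs : Exp n) (f : Exp (suc n) → ℕ) →
            ∑ (below (x ∷ xs)) f ≡ ∑[ i ∈ upTo (suc x) ] ∑[ b ∈ below xs ] f (i ∷ b)
∑-below-∷ x xs f =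
  trans (∑-concatMap (upTo (suc x)) (λ i → map (i ∷_) (below xs)) f) (∑-cong (upTo (suc x)) (λ i → ∑-map (below xs) (i ∷_) f))

δ₁-convolution : ∀ x y a → ∑[ i ∈ upTo (suc a) ] (δ₁ x i * δ₁ y (a ∸ i)) ≡ δ₁ (x + y) a
δ₁-convolution zero y zero = trans (+-identityʳ _) (+-identityʳ _)
δ₁-convolution (suc x) y zero = refl
δ₁-convolution zero y (suc a) =
  trans (∑-upTo-suc (suc a) (λ i → δ₁ 0 i * δ₁ y (suc a ∸ i)))
        (trans (cong₂ _+_ (+-identityʳ _) (∑-zero (upTo (suc a)))) (+-identityʳ _))
δ₁-convolution (suc x) y (suc a) =
  trans (∑-upTo-suc (suc a) (λ i → δ₁ (suc x) i * δ₁ y (suc a ∸ i))) (δ₁-convolution x y a)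

δ-convolution : ∀ (x y a : Exp n) → ∑[ b ∈ below a ] (δ x b * δ y (zipWith _∸_ a b)) ≡ δ (x ⊕ y) a
δ-convolution [] [] [] = refl
δ-convolution (x ∷ xs) (y ∷ ys) (a ∷ as) = begin
  ∑[ b ∈ below (a ∷ as) ] (δ (x ∷ xs) b * δ (y ∷ ys) (zipWith _∸_ (a ∷ as) b))
    ≡⟨ ∑-below-∷ a as _ ⟩
  ∑[ i ∈ upTo (suc a) ] ∑[ b ∈ below as ] (δ₁ x i * δ xs b * (δ₁ y (a ∸ i) * δ ys (zipWith _∸_ as b)))
    ≡⟨ ∑-cong (upTo (suc a)) (λ i → ∑-cong (below as) (λ b → *-interchange (δ₁ x i) _ _ _)) ⟩
  ∑[ i ∈ upTo (suc a) ] ∑[ b ∈ below as ] (δ₁ x i * δ₁ y (a ∸ i) * (δ xs b * δ ys (zipWith _∸_ as b)))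
    ≡⟨ ∑-cong (upTo (suc a)) (λ i → trans (∑-*ˡ (below as) (δ₁ x i * δ₁ y (a ∸ i)) _)
                                           (cong (δ₁ x i * δ₁ y (a ∸ i) *_) (δ-convolution xs ys as))) ⟩
  ∑[ i ∈ upTo (suc a) ] (δ₁ x i * δ₁ y (a ∸ i) * δ (xs ⊕ ys) as)
    ≡⟨ trans (∑-*ʳ (upTo (suc a)) (λ i → δ₁ x i * δ₁ y (a ∸ i)) _) (cong (_* δ (xs ⊕ ys) as) (δ₁-convolution x y a)) ⟩
  δ₁ (x + y) a * δ (xs ⊕ ys) as ∎
  where
  open import Algebra.Properties.CommutativeSemigroup *-commutativeSemigroup using () renaming (interchange to *-interchange)

-- f agrees with Σ_{x ∈ L} q^x up to total degree N; the bound makes the geometric series finite.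
_Lists_UpTo_ : List (Exp n) → FPS n → ℕ → Set
L Lists f UpTo N = ∀ b → total b ≤ N → f b ≡ ℤ.+ (∑[ x ∈ L ] δ x b)

-- Multiplication of the listed series by 1 + q^e + ... + q^(Ne).
expand : ℕ → Exp n → List (Exp n) → List (Exp n)
expand N e = concatMap (λ x → map (λ k → x ⊕ k · e) (upTo (suc N)))

∈-below⇒total≤ : ∀ (a : Exp n) {b} → b ∈ below a → total b ≤ total a
∈-below⇒total≤ []       (here refl) = z≤n
∈-below⇒total≤ (x ∷ xs) b∈ with ∈-concat⁻′ (map (λ i → map (i ∷_) (below xs)) (upTo (suc x))) b∈
... | l , b∈l , l∈ with ∈-map⁻ (λ i → map (i ∷_) (below xs)) l∈
... | i , i∈ , refl with ∈-map⁻ (i ∷_) b∈l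
... | b , b∈ , refl = +-mono-≤ (≤-pred (∈-upTo⁻ i∈)) (∈-below⇒total≤ xs b∈)

total-∸ : ∀ (a b : Exp n) → total (zipWith _∸_ a b) ≤ total a
total-∸ []       []       = z≤n
total-∸ (x ∷ xs) (y ∷ ys) = +-mono-≤ (m∸n≤m x y) (total-∸ xs ys)

total-· : ∀ k (e : Exp n) → total (k · e) ≡ k * total e
total-· k []       = sym (*-zeroʳ k)
total-· k (x ∷ xs) = trans (cong (k * x +_) (total-· k xs)) (sym (*-distribˡ-+ k x _))

-- As `total e` is positive, k e = b forces k ≤ `total b`, so enlarging the range adds only zeros. A
-- range that is the same for all b is what allows the sums to be swapped later.
geom-truncated : ∀ (e : Exp n) → 0 < total e → ∀ {N} b → total b ≤ N →
                 geom e b ≡ ℤ.+ (∑[ k ∈ upTo (suc N) ] δ (k · e) b)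
geom-truncated e e≠0 {N} b b≤N = cong ℤ.+_ (begin
  length (filterᵇ (λ k → (k · e) ≟ₑ b) (upTo (suc (total b))))
    ≡⟨ length-filterᵇ _ (upTo (suc (total b))) ⟩
  ∑[ k ∈ upTo (suc (total b)) ] ⟦ (k · e) ≟ₑ b ⟧
    ≡⟨ ∑-cong (upTo (suc (total b))) (λ k → ⟦≟ₑ⟧ (k · e) b) ⟩
  ∑[ k ∈ upTo (suc (total b)) ] δ (k · e) b
    ≡⟨ ∑-upTo-truncate (λ k → δ (k · e) b) (s≤s b≤N) (λ b<k → δ-≢ (λ eq → <⇒≱ b<k (k≤ _ eq))) ⟨
  ∑[ k ∈ upTo (suc N) ] δ (k · e) b ∎)
  where
  k≤ : ∀ k → k · e ≡ b → k ≤ total b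
  k≤ k eq = ≤-trans (m≤m*n k (total e) {{>-nonZero e≠0}})
                    (≤-reflexive (trans (sym (total-· k e)) (cong total eq)))

sumℤ-+ : ∀ (xs : List A) (f : A → ℤ) (g : A → ℕ) → (∀ {x} → x ∈ xs → f x ≡ ℤ.+ g x) →
         sumℤ (map f xs) ≡ ℤ.+ ∑ xs g
sumℤ-+ []       f g eq = refl
sumℤ-+ (x ∷ xs) f g eq = cong₂ ℤ._+_ (eq (here refl)) (sumℤ-+ xs f g (eq ∘ there))

∑-product : ∀ (xs : List A) (ys : List B) (f : A → ℕ) (g : B → ℕ) →
            ∑ xs f * ∑ ys g ≡ ∑[ x ∈ xs ] ∑[ y ∈ ys ] (f x * g y)
∑-product xs ys f g =
  trans (sym (∑-*ʳ xs f _)) (∑-cong xs (λ x → sym (∑-*ˡ ys (f x) g)))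

-- Both factors in the convolution are read at exponents of total degree at most that of a, hence
-- within the truncation; after swapping sums only a convolution of two deltas is left.
⋆-geom-lists : ∀ {N} (L : List (Exp n)) {f} e → 0 < total e →
               L Lists f UpTo N → expand N e L Lists (f ⋆ geom e) UpTo N
⋆-geom-lists {N = N} L {f} e e≠0 L-f a a≤N = begin
  sumℤ (map (λ b → f b ℤ.* geom e (zipWith _∸_ a b)) (below a))
    ≡⟨ sumℤ-+ (below a) _ _ (λ {b} b∈ →
         trans (cong₂ ℤ._*_ (L-f b (≤-trans (∈-below⇒total≤ a b∈) a≤N))
                            (geom-truncated e e≠0 _ (≤-trans (total-∸ a b) a≤N)))
               (sym (ℤₚ.pos-* (∑[ x ∈ L ] δ x b) _))) ⟩
  ℤ.+ (∑[ b ∈ below a ] ((∑[ x ∈ L ] δ x b) * ∑[ k ∈ K ] δ (k · e) (zipWith _∸_ a b)))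
    ≡⟨ cong ℤ.+_ (begin
  ∑[ b ∈ below a ] ((∑[ x ∈ L ] δ x b) * ∑[ k ∈ K ] δ (k · e) (zipWith _∸_ a b))
    ≡⟨ ∑-cong (below a) (λ b → ∑-product L K (λ x → δ x b) (λ k → δ (k · e) (zipWith _∸_ a b))) ⟩
  ∑[ b ∈ below a ] ∑[ x ∈ L ] ∑[ k ∈ K ] (δ x b * δ (k · e) (zipWith _∸_ a b))
    ≡⟨ ∑-swap (below a) L _ ⟩
  ∑[ x ∈ L ] ∑[ b ∈ below a ] ∑[ k ∈ K ] (δ x b * δ (k · e) (zipWith _∸_ a b))
    ≡⟨ ∑-cong L (λ x → trans (∑-swap (below a) K _) (∑-cong K (λ k → δ-convolution x (k · e) a))) ⟩
  ∑[ x ∈ L ] ∑[ k ∈ K ] δ (x ⊕ k · e) a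
    ≡⟨ trans (∑-concatMap L (λ x → map (λ k → x ⊕ k · e) K) (λ x → δ x a))
             (∑-cong L (λ x → ∑-map K (λ k → x ⊕ k · e) (λ x → δ x a))) ⟨
  ∑[ x ∈ expand N e L ] δ x a ∎) ⟩
  ℤ.+ (∑[ x ∈ expand N e L ] δ x a) ∎
  where
  K = upTo (suc N)

-- Sum of φ over the exponents x + Σ k_e e, with 0 ≤ k_e ≤ N for every e in the list
spread : ℕ → List (Exp n) → (Exp n → ℕ) → Exp n → ℕ
spread N []       φ = φ
spread N (e ∷ es) φ = spread N es (λ x → ∑[ k ∈ upTo (suc N) ] φ (x ⊕ k · e))

-- Trades the enlarged list for an enlarged summand, so that the outer sum runs over the numerator
-- alone.
∑-spread : ∀ N (L es : List (Exp n)) φ → ∑ (foldr (expand N) L es) φ ≡ ∑ L (spread N es φ)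
∑-spread N L []       φ = refl
∑-spread N L (e ∷ es) φ = begin
  ∑ (expand N e L′) φ
    ≡⟨ ∑-concatMap L′ (λ x → map (λ k → x ⊕ k · e) (upTo (suc N))) φ ⟩
  ∑[ x ∈ L′ ] ∑ (map (λ k → x ⊕ k · e) (upTo (suc N))) φ
    ≡⟨ ∑-cong L′ (λ x → ∑-map (upTo (suc N)) (λ k → x ⊕ k · e) φ) ⟩
  ∑[ x ∈ L′ ] ∑[ k ∈ upTo (suc N) ] φ (x ⊕ k · e)
    ≡⟨ ∑-spread N L es _ ⟩
  ∑ L (spread N (e ∷ es) φ) ∎
  where
  L′ = foldr (expand N) L es

foldr-⋆-geom-lists : ∀ {N} (L : List (Exp n)) {f} {es} → All (λ e → 0 < total e) es → L Lists f UpTo N →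
                     foldr (expand N) L es Lists foldr (λ e f → f ⋆ geom e) f es UpTo N
foldr-⋆-geom-lists L []                L-f = L-f
foldr-⋆-geom-lists {N = N} L (_∷_ {x = e} {xs = es} p ps) L-f =
  ⋆-geom-lists (foldr (expand N) L es) e p (foldr-⋆-geom-lists L ps L-f)

-- The coordinates c of a partition a = suf c are its successive differences:
-- q^a = ∏ (q₁⋯qᵢ)^cᵢ.

suf : Exp n → Exp n
suf []       = []
suf (c ∷ cs) = c + total cs ∷ suf cs

total-⊕ : ∀ (x y : Exp n) → total (x ⊕ y) ≡ total x + total y
total-⊕ []       []       = refl
total-⊕ (x ∷ xs) (y ∷ ys) = trans (cong (x + y +_) (total-⊕ xs ys)) (interchange x y _ _)

suf-⊕ : ∀ (x y : Exp n) → suf (x ⊕ y) ≡ suf x ⊕ suf y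
suf-⊕ []       []       = refl
suf-⊕ (x ∷ xs) (y ∷ ys) =
  cong₂ _∷_ (trans (cong (x + y +_) (total-⊕ xs ys)) (interchange x y _ _)) (suf-⊕ xs ys)

suf-· : ∀ k (x : Exp n) → suf (k · x) ≡ k · suf x
suf-· k []       = refl
suf-· k (x ∷ xs) =
  cong₂ _∷_ (trans (cong (k * x +_) (total-· k xs)) (sym (*-distribˡ-+ k x _))) (suf-· k xs)

suf-injective : ∀ {x y : Exp n} → suf x ≡ suf y → x ≡ y
suf-injective {x = []}     {[]}     eq = refl
suf-injective {x = x ∷ xs} {y ∷ ys} eq with suf-injective {x = xs} {ys} (cong Vec.tail eq)
... | refl = cong (_∷ xs) (+-cancelʳ-≡ (total xs) x y (cong Vec.head eq))

δ-suf : ∀ (x y : Exp n) → δ (suf x) (suf y) ≡ δ x y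
δ-suf x y with ≡-dec _≟_ x y
... | yes refl = trans (δ-refl (suf x)) (sym (δ-refl x))
... | no x≢y   = trans (δ-≢ (x≢y ∘ suf-injective)) (sym (δ-≢ x≢y))

-- Carries the truncation bound, given in the q-degree, over to the difference coordinates.
total≤total-suf : ∀ (x : Exp n) → total x ≤ total (suf x)
total≤total-suf []       = z≤n
total≤total-suf (x ∷ xs) = +-mono-≤ (m≤m+n x _) (total≤total-suf xs)

-- The difference coordinates of the exponents of (q₁⋯qᵢ)²
units₂ : ∀ n → List (Exp n)
units₂ zero    = []
units₂ (suc n) = (2 ∷ Vec.replicate n 0) ∷ map (0 ∷_) (units₂ n)

total-zeros : ∀ n → total (Vec.replicate n 0) ≡ 0
total-zeros zero    = refl
total-zeros (suc n) = total-zeros n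

total-units₂ : ∀ n → All (λ e → total e ≡ 2) (units₂ n)
total-units₂ zero    = []
total-units₂ (suc n) = cong (2 +_) (total-zeros n) ∷ Allₚ.map⁺ (total-units₂ n)

suf-zeros : ∀ n → suf (Vec.replicate n 0) ≡ Vec.replicate n 0
suf-zeros zero    = refl
suf-zeros (suc n) = cong₂ _∷_ (total-zeros n) (suf-zeros n)

tabulate-zeros : ∀ n → tabulate (λ (_ : Fin n) → 0) ≡ Vec.replicate n 0
tabulate-zeros zero    = refl
tabulate-zeros (suc n) = cong (0 ∷_) (tabulate-zeros n)

-- The tail sums of twice the i-th unit vector are 2 up to place i and 0 afterwards. In the
-- induction, prepending 0 to a vector of total 2 prepends 2 to its tail sums.
sqPrefixes : ∀ n → map (λ i → sqPrefix n (suc i)) (upTo n) ≡ map suf (units₂ n)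
sqPrefixes zero    = refl
sqPrefixes (suc n) = begin
  map (λ i → sqPrefix (suc n) (suc i)) (upTo (suc n))
    ≡⟨ cong (map _) (upTo-suc n) ⟩
  (2 ∷ tabulate (λ _ → 0)) ∷ map (λ i → sqPrefix (suc n) (suc i)) (map suc (upTo n))
    ≡⟨ cong₂ _∷_ (cong₂ _∷_ (cong (2 +_) (sym (total-zeros n))) (trans (tabulate-zeros n) (sym (suf-zeros n))))
                 (sym (map-∘ (upTo n))) ⟩
  e ∷ map (λ i → 2 ∷ sqPrefix n (suc i)) (upTo n)
    ≡⟨ cong (e ∷_) (map-∘ (upTo n)) ⟩
  e ∷ map (2 ∷_) (map (λ i → sqPrefix n (suc i)) (upTo n))
    ≡⟨ cong (λ l → e ∷ map (2 ∷_) l) (sqPrefixes n) ⟩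
  e ∷ map (2 ∷_) (map suf (units₂ n))
    ≡⟨ cong (e ∷_) (tails (total-units₂ n)) ⟩
  map suf (units₂ (suc n)) ∎
  where
  e = suf (2 ∷ Vec.replicate n 0)

  tails : ∀ {es : List (Exp n)} → All (λ e → total e ≡ 2) es → map (2 ∷_) (map suf es) ≡ map suf (map (0 ∷_) es)
  tails []                  = refl
  tails (_∷_ {x = e} eq eqs) = cong₂ _∷_ (cong (_∷ suf e) (sym eq)) (tails eqs)

-- `suf` is additive and commutes with multiples, so the change of variables passes through every
-- summation.
spread-suf : ∀ N (es : List (Exp n)) {φ ψ} → (∀ x → φ (suf x) ≡ ψ x) →
             ∀ x → spread N (map suf es) φ (suf x) ≡ spread N es ψ x
spread-suf N []       eq = eq
spread-suf N (e ∷ es) {φ} eq = spread-suf N es λ x → ∑-cong (upTo (suc N)) λ k →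
  trans (cong φ (trans (cong (suf x ⊕_) (sym (suf-· k e))) (sym (suf-⊕ x (k · e))))) (eq _)

spread-0∷ : ∀ N (es : List (Exp n)) {φ ψ} h → (∀ y → φ (h ∷ y) ≡ ψ y) →
            ∀ y → spread N (map (0 ∷_) es) φ (h ∷ y) ≡ spread N es ψ y
spread-0∷ N []       h eq = eq
spread-0∷ N (e ∷ es) {φ} h eq = spread-0∷ N es h λ y → ∑-cong (upTo (suc N)) λ k →
  trans (cong (λ z → φ (z ∷ _)) (trans (cong (h +_) (*-zeroʳ k)) (+-identityʳ h))) (eq _)

spread-* : ∀ N (es : List (Exp n)) c {φ ψ} → (∀ x → φ x ≡ c * ψ x) →
           ∀ x → spread N es φ x ≡ c * spread N es ψ x
spread-* N []       c eq = eq
spread-* N (e ∷ es) c eq = spread-* N es c λ x →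
  trans (∑-cong (upTo (suc N)) (λ k → eq _)) (∑-*ˡ (upTo (suc N)) c _)

-- For c ≤ N, the coefficient of t^c in t^x / (1 - t²).
evenGaps : ℕ → ℕ → ℕ → ℕ
evenGaps N x c = ∑[ k ∈ upTo (suc N) ] δ₁ (x + k * 2) c

weight : ℕ → Exp n → Exp n → ℕ
weight N []       []       = 1
weight N (x ∷ xs) (c ∷ cs) = evenGaps N x c * weight N xs cs

⊕-zeros : ∀ k (x : Exp n) → x ⊕ k · Vec.replicate n 0 ≡ x
⊕-zeros k []       = refl
⊕-zeros k (x ∷ xs) = cong₂ _∷_ (trans (cong (x +_) (*-zeroʳ k)) (+-identityʳ x)) (⊕-zeros k xs)

-- The vectors in `units₂` have disjoint supports, so the sum over all multiples is a product over
-- coordinates. This is the gain from the variables tᵢ.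
spread-units₂ : ∀ N (c x : Exp n) → spread N (units₂ n) (λ y → δ y c) x ≡ weight N x c
spread-units₂ N []       []       = refl
spread-units₂ {suc n} N (c ∷ cs) (x ∷ xs) =
  trans (spread-0∷ N (units₂ n) x (λ y → refl) xs)
        (trans (spread-* N (units₂ n) (evenGaps N x c) pull xs)
               (cong (evenGaps N x c *_) (spread-units₂ N cs xs)))
  where
  pull : ∀ y → ∑[ k ∈ upTo (suc N) ] δ ((x ∷ y) ⊕ k · (2 ∷ Vec.replicate n 0)) (c ∷ cs) ≡ evenGaps N x c * δ y cs
  pull y = trans (∑-cong (upTo (suc N)) (λ k → cong (λ z → δ₁ (x + k * 2) c * δ z cs) (⊕-zeros k y)))
                 (∑-*ʳ (upTo (suc N)) (λ k → δ₁ (x + k * 2) c) _)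

rhs-suf-count : ∀ n (a : Exp n) → rhs n a ≡ ℤ.+ (∑[ σ ∈ Bn n ] spread (total a) (map suf (units₂ n)) (λ x → δ x a) (sigmaExp σ))
rhs-suf-count n a = begin
  rhs n a
    ≡⟨ cong-app (trans (sym (foldr-map (λ e f → f ⋆ geom e) (λ i → sqPrefix n (suc i)) (numerator n) (upTo n)))
                       (cong (foldr (λ e f → f ⋆ geom e) (numerator n)) (sqPrefixes n))) a ⟩
  foldr (λ e f → f ⋆ geom e) (numerator n) es a
    ≡⟨ foldr-⋆-geom-lists L es≠0 L-num a ≤-refl ⟩
  ℤ.+ (∑[ x ∈ foldr (expand (total a)) L es ] δ x a)
    ≡⟨ cong ℤ.+_ (trans (∑-spread (total a) L es (λ x → δ x a)) (∑-map (Bn n) sigmaExp _)) ⟩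
  ℤ.+ (∑[ σ ∈ Bn n ] spread (total a) es (λ x → δ x a) (sigmaExp σ)) ∎
  where
  L  = map sigmaExp (Bn n)
  es = map suf (units₂ n)

  es≠0 : All (λ e → 0 < total e) es
  es≠0 = Allₚ.map⁺ (All.map (λ {x} eq → ≤-trans (subst (0 <_) (sym eq) z<s) (total≤total-suf x)) (total-units₂ n))

  L-num : L Lists numerator n UpTo total a
  L-num b _ = cong ℤ.+_ (trans (length-filterᵇ (λ σ → sigmaExp σ ≟ₑ b) (Bn n))
    (trans (∑-cong (Bn n) (λ σ → ⟦≟ₑ⟧ (sigmaExp σ) b)) (sym (∑-map (Bn n) sigmaExp (λ x → δ x b)))))

-- Summing out the signs

∑-vecsOver-suc : ∀ (xs : List A) m (f : Vec A (suc m) → ℕ) →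
                 ∑ (vecsOver xs (suc m)) f ≡ ∑[ x ∈ xs ] ∑[ v ∈ vecsOver xs m ] f (x ∷ v)
∑-vecsOver-suc xs m f =
  trans (∑-concatMap xs (λ x → map (x ∷_) (vecsOver xs m)) f) (∑-cong xs (λ x → ∑-map (vecsOver xs m) (x ∷_) f))

boolVecs : ∀ n → List (Vec Bool n)
boolVecs = vecsOver (true ∷ false ∷ [])

∑-boolVecs-suc : ∀ n (f : Vec Bool (suc n) → ℕ) →
                 ∑ (boolVecs (suc n)) f ≡ ∑[ v ∈ boolVecs n ] f (true ∷ v) + ∑[ v ∈ boolVecs n ] f (false ∷ v)
∑-boolVecs-suc n f =
  trans (∑-vecsOver-suc _ n f) (cong (∑ (boolVecs n) (f ∘ (true ∷_)) +_) (+-identityʳ _))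

_≟ᵥ_ : (u v : Vec Bool n) → Dec (u ≡ v)
_≟ᵥ_ = ≡-dec Bool._≟_

∑-boolVecs-single : ∀ (u : Vec Bool n) (f : Vec Bool n → ℕ) → ∑[ v ∈ boolVecs n ] (⟦ does (u ≟ᵥ v) ⟧ * f v) ≡ f u
∑-boolVecs-single []       f = trans (+-identityʳ _) (+-identityʳ _)
∑-boolVecs-single {suc n} (true ∷ u) f =
  trans (∑-boolVecs-suc n (λ v → ⟦ does ((true ∷ u) ≟ᵥ v) ⟧ * f v))
        (trans (cong₂ _+_ (∑-boolVecs-single u (f ∘ (true ∷_))) (∑-zero (boolVecs n))) (+-identityʳ _))
∑-boolVecs-single {suc n} (false ∷ u) f =
  trans (∑-boolVecs-suc n (λ v → ⟦ does ((false ∷ u) ≟ᵥ v) ⟧ * f v))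
        (cong₂ _+_ (∑-zero (boolVecs n)) (∑-boolVecs-single u (f ∘ (false ∷_))))

bits : Vec Bool n → Exp n
bits = Vec.map ⟦_⟧

-- The indicator of D ⊆ supp c, that is, the coefficient of t^c in t^D ∏ 1 / (1 - tᵢ).
allowed : Vec Bool n → Exp n → ℕ
allowed []          []           = 1
allowed (false ∷ D) (_ ∷ cs)     = allowed D cs
allowed (true ∷ D)  (zero ∷ cs)  = 0
allowed (true ∷ D)  (suc _ ∷ cs) = allowed D cs

-- Since c − D ≥ 0 is uniquely S + 2k with S ∈ {0,1}, the signs absorb the evenness of the denominator.
∑-parity : ∀ M t → t < M * 2 → ∑[ k ∈ upTo M ] (δ₁ (k * 2) t + δ₁ (suc (k * 2)) t) ≡ 1
∑-parity (suc M) zero          t<2M =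
  trans (∑-upTo-suc M (λ k → δ₁ (k * 2) 0 + δ₁ (suc (k * 2)) 0)) (cong suc (∑-zero (upTo M)))
∑-parity (suc M) (suc zero)    t<2M =
  trans (∑-upTo-suc M (λ k → δ₁ (k * 2) 1 + δ₁ (suc (k * 2)) 1)) (cong suc (∑-zero (upTo M)))
∑-parity (suc M) (suc (suc t)) (s≤s (s≤s t<2M)) =
  trans (∑-upTo-suc M (λ k → δ₁ (k * 2) (2 + t) + δ₁ (suc (k * 2)) (2 + t))) (∑-parity M t t<2M)

-- The identity (1 + t) / (1 - t²) = 1 / (1 - t), read at t^c.
evenGaps-0+1 : ∀ {N c} → c ≤ N → evenGaps N 0 c + evenGaps N 1 c ≡ 1
evenGaps-0+1 {N} {c} c≤N =
  trans (sym (∑-+ (upTo (suc N)) (λ k → δ₁ (k * 2) c) _))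
        (∑-parity (suc N) c (≤-trans (s≤s c≤N) (m≤m*n (suc N) 2)))

∑-signs-weight : ∀ {N} (D : Vec Bool n) c → total c ≤ N →
                 ∑[ S ∈ boolVecs n ] weight N (bits D ⊕ bits S) c ≡ allowed D c
∑-signs-weight [] [] c≤N = refl
∑-signs-weight {suc n} {N} (b ∷ D) (c ∷ cs) c≤N = begin
  ∑[ S ∈ boolVecs (suc n) ] weight N (bits (b ∷ D) ⊕ bits S) (c ∷ cs)
    ≡⟨ ∑-boolVecs-suc n (λ S → weight N (bits (b ∷ D) ⊕ bits S) (c ∷ cs)) ⟩
  ∑[ S ∈ boolVecs n ] (evenGaps N (⟦ b ⟧ + 1) c * weight N (bits D ⊕ bits S) cs)
    + ∑[ S ∈ boolVecs n ] (evenGaps N (⟦ b ⟧ + 0) c * weight N (bits D ⊕ bits S) cs)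
    ≡⟨ cong₂ _+_ (pull (⟦ b ⟧ + 1)) (pull (⟦ b ⟧ + 0)) ⟩
  evenGaps N (⟦ b ⟧ + 1) c * w + evenGaps N (⟦ b ⟧ + 0) c * w
    ≡⟨ *-distribʳ-+ w (evenGaps N (⟦ b ⟧ + 1) c) _ ⟨
  (evenGaps N (⟦ b ⟧ + 1) c + evenGaps N (⟦ b ⟧ + 0) c) * w
    ≡⟨ cong₂ _*_ (+-comm (evenGaps N (⟦ b ⟧ + 1) c) _) (∑-signs-weight D cs (m+n≤o⇒n≤o c c≤N)) ⟩
  (evenGaps N (⟦ b ⟧ + 0) c + evenGaps N (⟦ b ⟧ + 1) c) * allowed D cs
    ≡⟨ last b c (m+n≤o⇒m≤o c c≤N) ⟩
  allowed (b ∷ D) (c ∷ cs) ∎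
  where
  w = ∑[ S ∈ boolVecs n ] weight N (bits D ⊕ bits S) cs

  pull : ∀ x → ∑[ S ∈ boolVecs n ] (evenGaps N x c * weight N (bits D ⊕ bits S) cs) ≡ evenGaps N x c * w
  pull x = ∑-*ˡ (boolVecs n) (evenGaps N x c) (λ S → weight N (bits D ⊕ bits S) cs)

  last : ∀ b c → c ≤ N → (evenGaps N (⟦ b ⟧ + 0) c + evenGaps N (⟦ b ⟧ + 1) c) * allowed D cs ≡ allowed (b ∷ D) (c ∷ cs)
  last false c       c≤N = trans (cong (_* allowed D cs) (evenGaps-0+1 c≤N)) (+-identityʳ _)
  last true  zero    c≤N = cong (_* allowed D cs) (cong₂ _+_ (∑-zero (upTo N′)) (∑-zero (upTo N′)))
    where N′ = suc N
  -- Starting from 1 and 2 against `suc c` computes to starting from 0 and 1 against `c`.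
  last true  (suc c) c≤N = trans (cong (_* allowed D cs) (evenGaps-0+1 (≤-trans (n≤1+n c) c≤N))) (+-identityʳ _)

-- Orderings with prescribed descents

-- Sum of F over the descent sets of the words x y₁ … y_m, where y₁, …, y_m
-- run over the orderings of an m-element set with exactly g elements above x.
∑-orderings : (m g : ℕ) → (Vec Bool (suc m) → ℕ) → ℕ
∑-orderings zero    g F = F (false ∷ [])
∑-orderings (suc m) g F = ∑[ j ∈ upTo (suc m) ] ∑-orderings m j (λ D → F ((g ≤ᵇ j) ∷ D))

∑-orderings-cong : ∀ m g {F G} → (∀ D → F D ≡ G D) → ∑-orderings m g F ≡ ∑-orderings m g G
∑-orderings-cong zero    g F≗G = F≗G _
∑-orderings-cong (suc m) g F≗G =
  ∑-cong (upTo (suc m)) (λ j → ∑-orderings-cong m j (λ D → F≗G _))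

∑-orderings-∑ : ∀ m g (xs : List A) (F : A → Vec Bool (suc m) → ℕ) →
                ∑[ x ∈ xs ] ∑-orderings m g (F x) ≡ ∑-orderings m g (λ D → ∑[ x ∈ xs ] F x D)
∑-orderings-∑ zero    g xs F = refl
∑-orderings-∑ (suc m) g xs F =
  trans (∑-swap xs (upTo (suc m)) _)
        (∑-cong (upTo (suc m)) (λ j → ∑-orderings-∑ m j xs (λ x D → F x ((g ≤ᵇ j) ∷ D))))

∑-orderings-zero : ∀ m g → ∑-orderings m g (λ _ → 0) ≡ 0
-- The zero function is a sum over an empty list of functions; the element type ℕ is arbitrary.
∑-orderings-zero m g = sym (∑-orderings-∑ m g [] (λ (x : ℕ) _ → 0))

hockey-stick : ∀ k g → ∑[ j ∈ upTo g ] (j C k) ≡ g C suc k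
hockey-stick k zero    = refl
hockey-stick k (suc g) = begin
  ∑[ j ∈ upTo (suc g) ] (j C k)   ≡⟨ ∑-upTo-last g (_C k) ⟩
  ∑[ j ∈ upTo g ] (j C k) + g C k ≡⟨ cong (_+ g C k) (hockey-stick k g) ⟩
  g C suc k + g C k               ≡⟨ +-comm (g C suc k) _ ⟩
  g C k + g C suc k               ≡⟨ nCk+nC[k+1]≡[n+1]C[k+1] g k ⟩
  suc g C suc k                   ∎

-- The number of copies of the largest part of suf c
top : Exp n → ℕ
top []           = 0
top (zero ∷ cs)  = suc (top cs)
top (suc _ ∷ cs) = 1

-- The multinomial coefficient of suf c with its largest part left out
residual : Exp n → ℕ
residual []                   = 1
residual (zero ∷ cs)          = residual cs
residual {suc n} (suc _ ∷ cs) = (n C top cs) * residual cs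

private
  >⇒≤ᵇ-false : ∀ {g j} → j < g → (g ≤ᵇ j) ≡ false
  >⇒≤ᵇ-false {g} {j} j<g with g ≤ᵇ j in eq
  ... | false = refl
  ... | true  = contradiction (≤ᵇ⇒≤ g j (subst T (sym eq) _)) (<⇒≱ j<g)

  ≤⇒≤ᵇ-true : ∀ {g j} → g ≤ j → (g ≤ᵇ j) ≡ true
  ≤⇒≤ᵇ-true {g} {j} g≤j with g ≤ᵇ j in eq
  ... | true  = refl
  ... | false = ⊥-elim (subst T eq (≤⇒≤ᵇ g≤j))

mutual
  -- A descent right after x is forbidden, so the next letter has j < g. The rest of the run of x
  -- consists of `top c` letters, all chosen among the g elements above x.
  ∑-orderings-allowed-0 : ∀ {m} g (c : Exp m) → g ≤ m →
                          ∑-orderings m g (λ D → allowed D (0 ∷ c)) ≡ (g C top c) * residual c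
  ∑-orderings-allowed-0 zero [] z≤n = refl
  ∑-orderings-allowed-0 {suc m} g c g≤m = begin
    ∑[ j ∈ upTo (suc m) ] ∑-orderings m j (λ D → allowed ((g ≤ᵇ j) ∷ D) (0 ∷ c))
      ≡⟨ ∑-upTo-truncate _ g≤m (λ {j} g≤j →
           trans (∑-orderings-cong m j (λ D → cong (λ b → allowed (b ∷ D) (0 ∷ c)) (≤⇒≤ᵇ-true g≤j)))
                 (∑-orderings-zero m j)) ⟩
    ∑[ j ∈ upTo g ] ∑-orderings m j (λ D → allowed ((g ≤ᵇ j) ∷ D) (0 ∷ c))
      ≡⟨ ∑-cong-∈ (upTo g) (λ {j} j∈ →
           ∑-orderings-cong m j (λ D → cong (λ b → allowed (b ∷ D) (0 ∷ c)) (>⇒≤ᵇ-false (∈-upTo⁻ j∈)))) ⟩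
    ∑[ j ∈ upTo g ] ∑-orderings m j (λ D → allowed D c)
      ≡⟨ ∑-orderings-allowed g c g≤m ⟩
    (g C top c) * residual c ∎

  -- The run may end at x, so the next letter is free and the next block is any subset of size
  -- `top c` of the m remaining elements.
  ∑-orderings-allowed-suc : ∀ {m} g x (c : Exp m) →
                            ∑-orderings m g (λ D → allowed D (suc x ∷ c)) ≡ (m C top c) * residual c
  ∑-orderings-allowed-suc g x [] = refl
  ∑-orderings-allowed-suc {suc m} g x c =
    trans (∑-cong (upTo (suc m)) (λ j → ∑-orderings-cong m j (λ D → either (g ≤ᵇ j) D)))
          (∑-orderings-allowed (suc m) c ≤-refl)
    where
    either : ∀ b D → allowed (b ∷ D) (suc x ∷ c) ≡ allowed D c
    either true  D = refl
    either false D = refl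

  -- The first block is a subset of the g largest of the m + 1 elements. Fixing its least letter,
  -- which comes first, gives the hockey-stick sum; a block of one letter leaves g choices.
  ∑-orderings-allowed : ∀ {m} g (c : Exp (suc m)) → g ≤ suc m →
                        ∑[ j ∈ upTo g ] ∑-orderings m j (λ D → allowed D c) ≡ (g C top c) * residual c
  ∑-orderings-allowed {m} g (zero ∷ cs) g≤ = begin
    ∑[ j ∈ upTo g ] ∑-orderings m j (λ D → allowed D (0 ∷ cs))
      ≡⟨ ∑-cong-∈ (upTo g) (λ {j} j∈ → ∑-orderings-allowed-0 j cs (≤-pred (≤-trans (∈-upTo⁻ j∈) g≤))) ⟩
    ∑[ j ∈ upTo g ] ((j C top cs) * residual cs)
      ≡⟨ ∑-*ʳ (upTo g) (_C top cs) _ ⟩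
    (∑[ j ∈ upTo g ] (j C top cs)) * residual cs
      ≡⟨ cong (_* residual cs) (hockey-stick (top cs) g) ⟩
    (g C suc (top cs)) * residual cs ∎
  ∑-orderings-allowed {m} g (suc x ∷ cs) g≤ = begin
    ∑[ j ∈ upTo g ] ∑-orderings m j (λ D → allowed D (suc x ∷ cs))
      ≡⟨ ∑-cong (upTo g) (λ j → ∑-orderings-allowed-suc j x cs) ⟩
    ∑[ j ∈ upTo g ] ((m C top cs) * residual cs)
      ≡⟨ ∑-const (upTo g) _ ⟩
    length (upTo g) * ((m C top cs) * residual cs)
      ≡⟨ cong (_* ((m C top cs) * residual cs)) (trans (length-upTo g) (sym (nC1≡n g))) ⟩
    (g C 1) * ((m C top cs) * residual cs) ∎

-- Multinomial coefficients

[k+s]Ck*k!*s! : ∀ k s → ((k + s) C k) * (k ! * s !) ≡ (k + s) !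
[k+s]Ck*k!*s! k s = begin
  ((k + s) C k) * (k ! * s !)
    ≡⟨ cong (λ t → ((k + s) C k) * (k ! * t !)) (m+n∸m≡n k s) ⟨
  ((k + s) C k) * (k ! * ((k + s) ∸ k) !)
    ≡⟨ cong (_* (k ! * ((k + s) ∸ k) !)) (nCk≡n!/k![n-k]! (m≤m+n k s)) ⟩
  ((k + s) ! / (k ! * ((k + s) ∸ k) !)) * (k ! * ((k + s) ∸ k) !)
    ≡⟨ m/n*n≡m (subst (_∣ (k + s) !) (*-comm (((k + s) ∸ k) !) (k !)) ([n∸k]!k!∣n! (m≤m+n k s))) ⟩
  (k + s) ! ∎
  where instance _ = k !* ((k + s) ∸ k) !≢0

factorials : List ℕ → ℕ
factorials = product ∘ map _!

multinomial-factorials : ∀ ks → multinomial ks * factorials ks ≡ sum ks !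
multinomial-factorials []       = refl
multinomial-factorials (k ∷ ks) = begin
  ((k + sum ks) C k) * multinomial ks * (k ! * factorials ks) ≡⟨ rearrange ((k + sum ks) C k) _ (k !) _ ⟩
  ((k + sum ks) C k) * (k ! * (multinomial ks * factorials ks)) ≡⟨ cong (λ z → ((k + sum ks) C k) * (k ! * z)) (multinomial-factorials ks) ⟩
  ((k + sum ks) C k) * (k ! * sum ks !) ≡⟨ [k+s]Ck*k!*s! k (sum ks) ⟩
  (k + sum ks) ! ∎
  where
  rearrange : ∀ a b c d → a * b * (c * d) ≡ a * (c * (b * d))
  rearrange = solve-∀

factorials-∷ʳ : ∀ ks k → factorials (ks ++ k ∷ []) ≡ factorials ks * k !
factorials-∷ʳ []        k = *-comm (k !) 1
factorials-∷ʳ (k′ ∷ ks) k = trans (cong (k′ ! *_) (factorials-∷ʳ ks k)) (sym (*-assoc (k′ !) _ _))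

factorials≢0 : ∀ ks → NonZero (factorials ks)
factorials≢0 []       = _
factorials≢0 (k ∷ ks) = m*n≢0 (k !) (factorials ks) {{k !≢0}} {{factorials≢0 ks}}

sum-∷ʳ : ∀ ks k → sum (ks ++ k ∷ []) ≡ k + sum ks
sum-∷ʳ ks k = trans (sum-++ ks _) (trans (cong (sum ks +_) (+-identityʳ k)) (+-comm (sum ks) k))

-- `multinomial` peels entries off the front, from the value 0 upwards, while recursion on c adds
-- the largest part, at the end. Multiplied by the factorials of the entries, both expressions equal
-- the factorial of the sum.
multinomial-∷ʳ : ∀ ks k → multinomial (ks ++ k ∷ []) ≡ ((k + sum ks) C k) * multinomial ks
multinomial-∷ʳ ks k = *-cancelʳ-≡ _ _ (factorials (ks ++ k ∷ [])) {{factorials≢0 (ks ++ k ∷ [])}} (begin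
  multinomial (ks ++ k ∷ []) * factorials (ks ++ k ∷ [])
    ≡⟨ multinomial-factorials (ks ++ k ∷ []) ⟩
  sum (ks ++ k ∷ []) !
    ≡⟨ cong _! (sum-∷ʳ ks k) ⟩
  (k + sum ks) !
    ≡⟨ multinomial-factorials (k ∷ ks) ⟨
  ((k + sum ks) C k) * multinomial ks * (k ! * factorials ks)
    ≡⟨ cong (((k + sum ks) C k) * multinomial ks *_) (trans (*-comm (k !) _) (sym (factorials-∷ʳ ks k))) ⟩
  ((k + sum ks) C k) * multinomial ks * factorials (ks ++ k ∷ []) ∎)

-- Multiplicities of the parts in difference coordinates

mult-∷ : ∀ x l j → mult (x ∷ l) j ≡ δ₁ x j + mult l j
mult-∷ x l j with x ≡ᵇ j
... | true  = refl
... | false = refl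

parts : Exp n → List ℕ
parts c = toList (suf c)

mult-above : ∀ (c : Exp n) {j} → total c < j → mult (parts c) j ≡ 0
mult-above []       c<j = refl
mult-above (c ∷ cs) {j} c<j =
  trans (mult-∷ (c + total cs) (parts cs) j) (cong₂ _+_ (δ₁-≢ (<⇒≢ c<j)) (mult-above cs (≤-<-trans (m≤n+m (total cs) c) c<j)))

mult-total : ∀ (c : Exp n) → mult (parts c) (total c) ≡ top c
mult-total []           = refl
mult-total (zero ∷ cs)  =
  trans (mult-∷ (total cs) (parts cs) (total cs)) (cong₂ _+_ (δ₁-refl (total cs)) (mult-total cs))
mult-total (suc x ∷ cs) =
  trans (mult-∷ (suc x + total cs) (parts cs) (suc x + total cs))
        (cong₂ _+_ (δ₁-refl (x + total cs)) (mult-above cs (s≤s (m≤n+m (total cs) x))))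

-- The mⱼ for j below the largest part, which is `total c`. The largest part is kept apart because
-- its multiplicity can still grow when a new part is put in front.
lowerMultiplicities : Exp n → List ℕ
lowerMultiplicities c = map (mult (parts c)) (upTo (total c))

map-upTo-last : ∀ (f : ℕ → A) m → map f (upTo (suc m)) ≡ map f (upTo m) ++ f m ∷ []
map-upTo-last f m = trans (cong (map f) (sym (upTo-∷ʳ m))) (map-++ f (upTo m) _)

map-cong-∈ : ∀ (xs : List A) {f g : A → B} → (∀ {x} → x ∈ xs → f x ≡ g x) → map f xs ≡ map g xs
map-cong-∈ []       eq = refl
map-cong-∈ (x ∷ xs) eq = cong₂ _∷_ (eq (here refl)) (map-cong-∈ xs (eq ∘ there))

lowerMultiplicities-∷ : ∀ c (cs : Exp n) → lowerMultiplicities (c ∷ cs) ≡ map (mult (parts cs)) (upTo (c + total cs))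
lowerMultiplicities-∷ c cs = map-cong-∈ (upTo (c + total cs)) λ {j} j∈ →
  trans (mult-∷ (c + total cs) (parts cs) j) (cong (_+ mult (parts cs) j) (δ₁-≢ (>⇒≢ (∈-upTo⁻ j∈))))

multiplicities-suf : ∀ (c : Exp n) → multiplicities (parts c) ≡ lowerMultiplicities c ++ top c ∷ []
multiplicities-suf c = begin
  map (mult (parts c)) (upTo (suc (foldr _⊔_ 0 (parts c))))
    ≡⟨ cong (λ m → map (mult (parts c)) (upTo (suc m))) (max c) ⟩
  map (mult (parts c)) (upTo (suc (total c)))
    ≡⟨ map-upTo-last _ (total c) ⟩
  lowerMultiplicities c ++ mult (parts c) (total c) ∷ []
    ≡⟨ cong (λ k → lowerMultiplicities c ++ k ∷ []) (mult-total c) ⟩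
  lowerMultiplicities c ++ top c ∷ [] ∎
  where
  max : ∀ {n} (c : Exp n) → foldr _⊔_ 0 (parts c) ≡ total c
  max []       = refl
  max (c ∷ cs) = trans (cong (c + total cs ⊔_) (max cs)) (m≥n⇒m⊔n≡m (m≤n+m (total cs) c))

-- The former largest part now lies just below the new one, so its multiplicity joins the list.
lowerMultiplicities-1∷ : ∀ (cs : Exp n) → lowerMultiplicities (1 ∷ cs) ≡ lowerMultiplicities cs ++ top cs ∷ []
lowerMultiplicities-1∷ cs = begin
  lowerMultiplicities (1 ∷ cs)
    ≡⟨ lowerMultiplicities-∷ 1 cs ⟩
  map (mult (parts cs)) (upTo (suc (total cs)))
    ≡⟨ map-upTo-last _ (total cs) ⟩
  lowerMultiplicities cs ++ mult (parts cs) (total cs) ∷ []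
    ≡⟨ cong (λ k → lowerMultiplicities cs ++ k ∷ []) (mult-total cs) ⟩
  lowerMultiplicities cs ++ top cs ∷ [] ∎

-- Each further unit skips a value that no part takes; its multiplicity 0 leaves the multinomial
-- coefficient unchanged.
lowerMultiplicities-2+∷ : ∀ x (cs : Exp n) → lowerMultiplicities (2 + x ∷ cs) ≡ lowerMultiplicities (1 + x ∷ cs) ++ 0 ∷ []
lowerMultiplicities-2+∷ x cs = begin
  lowerMultiplicities (2 + x ∷ cs)
    ≡⟨ lowerMultiplicities-∷ (2 + x) cs ⟩
  map (mult (parts cs)) (upTo (suc m))
    ≡⟨ map-upTo-last _ m ⟩
  map (mult (parts cs)) (upTo m) ++ mult (parts cs) m ∷ []
    ≡⟨ cong₂ (λ ks k → ks ++ k ∷ []) (lowerMultiplicities-∷ (1 + x) cs)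
                                     (sym (mult-above cs (s≤s (m≤n+m (total cs) x)))) ⟨
  lowerMultiplicities (1 + x ∷ cs) ++ 0 ∷ [] ∎
  where
  m = 1 + x + total cs

sum-lowerMultiplicities-suc : ∀ x (cs : Exp n) →
  sum (lowerMultiplicities (suc x ∷ cs)) ≡ top cs + sum (lowerMultiplicities cs)
sum-lowerMultiplicities-suc zero    cs = trans (cong sum (lowerMultiplicities-1∷ cs)) (sum-∷ʳ (lowerMultiplicities cs) (top cs))
sum-lowerMultiplicities-suc (suc x) cs =
  trans (cong sum (lowerMultiplicities-2+∷ x cs))
        (trans (sum-∷ʳ (lowerMultiplicities (suc x ∷ cs)) 0) (sum-lowerMultiplicities-suc x cs))

multinomial-lowerMultiplicities-suc : ∀ x (cs : Exp n) →
  multinomial (lowerMultiplicities (suc x ∷ cs)) ≡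
  ((top cs + sum (lowerMultiplicities cs)) C top cs) * multinomial (lowerMultiplicities cs)
multinomial-lowerMultiplicities-suc zero    cs =
  trans (cong multinomial (lowerMultiplicities-1∷ cs)) (multinomial-∷ʳ (lowerMultiplicities cs) (top cs))
multinomial-lowerMultiplicities-suc (suc x) cs = begin
  multinomial (lowerMultiplicities (2 + x ∷ cs))
    ≡⟨ cong multinomial (lowerMultiplicities-2+∷ x cs) ⟩
  multinomial (lowerMultiplicities (1 + x ∷ cs) ++ 0 ∷ [])
    ≡⟨ multinomial-∷ʳ (lowerMultiplicities (1 + x ∷ cs)) 0 ⟩
  (sum (lowerMultiplicities (1 + x ∷ cs)) C 0) * multinomial (lowerMultiplicities (1 + x ∷ cs))
    ≡⟨ +-identityʳ _ ⟩
  multinomial (lowerMultiplicities (1 + x ∷ cs))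
    ≡⟨ multinomial-lowerMultiplicities-suc x cs ⟩
  ((top cs + sum (lowerMultiplicities cs)) C top cs) * multinomial (lowerMultiplicities cs) ∎

top+lowerMultiplicities : ∀ (c : Exp n) → top c + sum (lowerMultiplicities c) ≡ n
top+lowerMultiplicities []           = refl
top+lowerMultiplicities (zero ∷ cs)  =
  cong suc (trans (cong (λ l → top cs + sum l) (lowerMultiplicities-∷ 0 cs)) (top+lowerMultiplicities cs))
top+lowerMultiplicities (suc x ∷ cs) =
  cong suc (trans (sum-lowerMultiplicities-suc x cs) (top+lowerMultiplicities cs))

multinomial-lowerMultiplicities : ∀ (c : Exp n) → multinomial (lowerMultiplicities c) ≡ residual c
multinomial-lowerMultiplicities []           = refl
multinomial-lowerMultiplicities (zero ∷ cs)  =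
  trans (cong multinomial (lowerMultiplicities-∷ 0 cs)) (multinomial-lowerMultiplicities cs)
multinomial-lowerMultiplicities (suc x ∷ cs) =
  trans (multinomial-lowerMultiplicities-suc x cs)
        (cong₂ (λ m r → (m C top cs) * r) (top+lowerMultiplicities cs) (multinomial-lowerMultiplicities cs))

multinomial-multiplicities-suf : ∀ (c : Exp n) → multinomial (multiplicities (parts c)) ≡ (n C top c) * residual c
multinomial-multiplicities-suf {n} c = begin
  multinomial (multiplicities (parts c))
    ≡⟨ cong multinomial (multiplicities-suf c) ⟩
  multinomial (lowerMultiplicities c ++ top c ∷ [])
    ≡⟨ multinomial-∷ʳ (lowerMultiplicities c) (top c) ⟩
  ((top c + sum (lowerMultiplicities c)) C top c) * multinomial (lowerMultiplicities c)
    ≡⟨ cong₂ (λ m r → (m C top c) * r) (top+lowerMultiplicities c) (multinomial-lowerMultiplicities c) ⟩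
  (n C top c) * residual c ∎

-- Arrangements of a finite set of integers

-- Pigeonhole: the letters of `xs` can be struck out of `ys` one at a time, and the length bound
-- leaves nothing over.
unique-⊆⇒↭ : ∀ {xs ys : List A} → Unique xs → (∀ {x} → x ∈ xs → x ∈ ys) → length ys ≤ length xs → xs ↭ ys
unique-⊆⇒↭ {xs = []}     {[]} _          _     _    = refl
unique-⊆⇒↭ {xs = x ∷ xs} (x∉ ∷ uniq) xs⊆ys len with ∈-∃++ (xs⊆ys (here refl))
... | as , bs , refl = ↭-trans (prep x (unique-⊆⇒↭ uniq xs⊆ len′)) (↭-sym (shift x as bs))
  where
  xs⊆ : ∀ {z} → z ∈ xs → z ∈ as ++ bs
  xs⊆ z∈ with ∈-++⁻ as (xs⊆ys (there z∈))
  ... | inj₁ z∈as           = ∈-++⁺ˡ z∈as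
  ... | inj₂ (here refl)    = contradiction refl (All.lookup x∉ z∈)
  ... | inj₂ (there z∈bs)   = ∈-++⁺ʳ as z∈bs

  len′ : length (as ++ bs) ≤ length xs
  len′ = ≤-pred (≤-trans (≤-reflexive (trans (cong suc (length-++ as)) (trans (sym (+-suc (length as) (length bs)))
                                             (sym (length-++ as))))) len)

unique-map : ∀ {xs : List A} (f : A → B) → (∀ {x y} → x ∈ xs → y ∈ xs → f x ≡ f y → x ≡ y) →
             Unique xs → Unique (map f xs)
unique-map f inj []          = []
unique-map f inj (x∉ ∷ uniq) =
  Allₚ.map⁺ (All.tabulate (λ y∈ eq → All.lookup x∉ y∈ (inj (here refl) (there y∈) eq)))
  ∷ unique-map f (λ p q → inj (there p) (there q)) uniq

∑-mono-≤ : ∀ (xs : List A) {f g} → (∀ x → f x ≤ g x) → ∑ xs f ≤ ∑ xs g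
∑-mono-≤ []       f≤g = z≤n
∑-mono-≤ (x ∷ xs) f≤g = +-mono-≤ (f≤g x) (∑-mono-≤ xs f≤g)

∑-mono-< : ∀ (xs : List A) {f g} → (∀ x → f x ≤ g x) → ∀ {x} → x ∈ xs → f x < g x → ∑ xs f < ∑ xs g
∑-mono-< (x ∷ xs) f≤g (here refl) fx<gx = +-mono-<-≤ fx<gx (∑-mono-≤ xs f≤g)
∑-mono-< (x ∷ xs) f≤g (there x∈)  fx<gx = +-mono-≤-< (f≤g x) (∑-mono-< xs f≤g x∈ fx<gx)

-- The rank from the top, which becomes the argument g or j of `∑-orderings`.
above : List ℤ → ℤ → ℕ
above W y = ∑[ z ∈ W ] ⟦ does (y ℤ.<? z) ⟧

⟦does⟧≤ : ∀ {P Q : Set} (p? : Dec P) (q? : Dec Q) → (P → Q) → ⟦ does p? ⟧ ≤ ⟦ does q? ⟧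
⟦does⟧≤ (no _)  _       _   = z≤n
⟦does⟧≤ (yes _) (yes _) _   = ≤-refl
⟦does⟧≤ (yes p) (no ¬q) P⇒Q = contradiction (P⇒Q p) ¬q

above-mono-≤ : ∀ W {x y} → y ℤ.≤ x → above W x ≤ above W y
above-mono-≤ W {x} {y} y≤x =
  ∑-mono-≤ W (λ z → ⟦does⟧≤ (x ℤ.<? z) (y ℤ.<? z) (ℤₚ.≤-<-trans y≤x))

above-mono-< : ∀ W {x y} → y ∈ W → x ℤ.< y → above W y < above W x
above-mono-< W {x} {y} y∈ x<y =
  ∑-mono-< W (λ z → ⟦does⟧≤ (y ℤ.<? z) (x ℤ.<? z) (ℤₚ.<-trans x<y)) y∈
    (subst₂ _<_ (cong ⟦_⟧ (sym (dec-false (y ℤ.<? y) (ℤₚ.<-irrefl refl))))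
                (cong ⟦_⟧ (sym (dec-true (x ℤ.<? y) x<y))) z<s)

above-< : ∀ W {y} → y ∈ W → above W y < length W
above-< W {y} y∈ = ≤-trans
  (∑-mono-< W (λ z → ≤1 (does (y ℤ.<? z))) y∈
    (subst (_< 1) (cong ⟦_⟧ (sym (dec-false (y ℤ.<? y) (ℤₚ.<-irrefl refl)))) z<s))
  (≤-reflexive (trans (∑-const W 1) (*-identityʳ _)))
  where
  ≤1 : ∀ b → ⟦ b ⟧ ≤ 1
  ≤1 true  = ≤-refl
  ≤1 false = z≤n

above-injective : ∀ W {x y} → x ∈ W → y ∈ W → above W x ≡ above W y → x ≡ y
above-injective W {x} {y} x∈ y∈ eq with ℤₚ.<-cmp x y
... | tri< x<y _ _ = contradiction (sym eq) (<⇒≢ (above-mono-< W y∈ x<y))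
... | tri≈ _ x≡y _ = x≡y
... | tri> _ _ y<x = contradiction eq (<⇒≢ (above-mono-< W x∈ y<x))

-- The ranks in W are 0, ..., |W| - 1, each once. At this point the actual integers disappear, and
-- with them the dependence on the signs.
∑-above : ∀ {W} → Unique W → (h : ℕ → ℕ) → ∑[ y ∈ W ] h (above W y) ≡ ∑ (upTo (length W)) h
∑-above {W} uniq h = trans (sym (∑-map W (above W) h)) (∑-↭ h
  (unique-⊆⇒↭ (unique-map (above W) (above-injective W) uniq) ranks
    (≤-reflexive (trans (length-upTo (length W)) (sym (length-map (above W) W))))))
  where
  ranks : ∀ {j} → j ∈ map (above W) W → j ∈ upTo (length W)
  ranks j∈ with ∈-map⁻ (above W) j∈
  ... | y , y∈ , refl = ∈-upTo⁺ (above-< W y∈)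

-- If x < y, then y is counted above x but not above itself, which makes the ranks strictly
-- different.
above-≤ᵇ : ∀ W {x y} → y ∈ W → x ≢ y → (above W x ≤ᵇ above W y) ≡ ⌊ y ℤ.<? x ⌋
above-≤ᵇ W {x} {y} y∈ x≢y with y ℤ.<? x
... | yes y<x = ≤⇒≤ᵇ-true (above-mono-≤ W (ℤₚ.<⇒≤ y<x))
... | no y≮x  = >⇒≤ᵇ-false (above-mono-< W y∈ (ℤₚ.≤∧≢⇒< (ℤₚ.≮⇒≥ y≮x) x≢y))

without : ℤ → List ℤ → List ℤ
without y = filter (λ z → ¬? (y ℤ.≟ z))

length-without : ∀ {W y} → Unique W → y ∈ W → suc (length (without y W)) ≡ length W
length-without {x ∷ W} {y} (x∉ ∷ uniq) y∈ with y ℤ.≟ x | y∈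
... | yes refl | _         = cong (suc ∘ length) (filter-all (λ z → ¬? (y ℤ.≟ z)) x∉)
... | no y≢x   | here y≡x  = contradiction y≡x y≢x
... | no y≢x   | there y∈W = cong suc (length-without uniq y∈W)

above-without : ∀ W y → above (without y W) y ≡ above W y
above-without W y = trans (∑-filter _ W _) (∑-cong W absorb)
  where
  absorb : ∀ z → ⟦ not (does (y ℤ.≟ z)) ⟧ * ⟦ does (y ℤ.<? z) ⟧ ≡ ⟦ does (y ℤ.<? z) ⟧
  absorb z with y ℤ.≟ z
  ... | no  _    = +-identityʳ _
  ... | yes refl = cong ⟦_⟧ (sym (dec-false (y ℤ.<? y) (ℤₚ.<-irrefl refl)))

-- A condition on every entry amounts to a smaller alphabet. It serves both to delete a letter
-- already placed and to impose the signs S.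
∑-vecsOver-all : ∀ {P : Pred A 0ℓ} (P? : Decidable P) V m (f : Vec A m → ℕ) →
                 ∑[ v ∈ vecsOver V m ] (⟦ does (all? P? (toList v)) ⟧ * f v) ≡ ∑ (vecsOver (filter P? V) m) f
∑-vecsOver-all P? V zero    f = cong (_+ 0) (+-identityʳ _)
∑-vecsOver-all P? V (suc m) f = begin
  ∑[ v ∈ vecsOver V (suc m) ] (⟦ does (all? P? (toList v)) ⟧ * f v)
    ≡⟨ ∑-vecsOver-suc V m (λ v → ⟦ does (all? P? (toList v)) ⟧ * f v) ⟩
  ∑[ x ∈ V ] ∑[ v ∈ vecsOver V m ] (⟦ does (P? x) ∧ does (all? P? (toList v)) ⟧ * f (x ∷ v))
    ≡⟨ ∑-cong V (λ x → trans (∑-cong (vecsOver V m) (λ v →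
         trans (cong (_* f (x ∷ v)) (⟦∧⟧ (does (P? x)) _)) (*-assoc ⟦ does (P? x) ⟧ _ _)))
         (∑-*ˡ (vecsOver V m) ⟦ does (P? x) ⟧ (λ v → ⟦ does (all? P? (toList v)) ⟧ * f (x ∷ v)))) ⟩
  ∑[ x ∈ V ] (⟦ does (P? x) ⟧ * ∑[ v ∈ vecsOver V m ] (⟦ does (all? P? (toList v)) ⟧ * f (x ∷ v)))
    ≡⟨ ∑-filter P? V (λ x → ∑[ v ∈ vecsOver V m ] (⟦ does (all? P? (toList v)) ⟧ * f (x ∷ v))) ⟨
  ∑[ x ∈ filter P? V ] ∑[ v ∈ vecsOver V m ] (⟦ does (all? P? (toList v)) ⟧ * f (x ∷ v))
    ≡⟨ ∑-cong (filter P? V) (λ x → ∑-vecsOver-all P? V m (f ∘ (x ∷_))) ⟩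
  ∑[ x ∈ filter P? V ] ∑[ v ∈ vecsOver (filter P? V) m ] f (x ∷ v)
    ≡⟨ ∑-vecsOver-suc (filter P? V) m f ⟨
  ∑ (vecsOver (filter P? V) (suc m)) f ∎

∑-arrangements : List ℤ → (m : ℕ) → (Vec ℤ m → ℕ) → ℕ
∑-arrangements W m f = ∑[ v ∈ vecsOver W m ] (⟦ does (unique? (toList v)) ⟧ * f v)

∑-arrangements-suc : ∀ W m f → ∑-arrangements W (suc m) f ≡ ∑[ y ∈ W ] ∑-arrangements (without y W) m (λ v → f (y ∷ v))
∑-arrangements-suc W m f =
  trans (∑-vecsOver-suc W m (λ v → ⟦ does (unique? (toList v)) ⟧ * f v)) (∑-cong W λ y →
    trans (∑-cong (vecsOver W m) (λ v →
            trans (cong (_* f (y ∷ v)) (⟦∧⟧ (does (all? (λ z → ¬? (y ℤ.≟ z)) (toList v))) _))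
                  (*-assoc ⟦ does (all? (λ z → ¬? (y ℤ.≟ z)) (toList v)) ⟧ _ _)))
          (∑-vecsOver-all (λ z → ¬? (y ℤ.≟ z)) W m (λ v → ⟦ does (unique? (toList v)) ⟧ * f (y ∷ v))))

-- The closing `false` stands for position n, never a descent; it gives descents and signs vectors
-- of equal length.
desBits : Vec ℤ n → Vec Bool n
desBits []          = []
desBits (x ∷ [])    = false ∷ []
desBits (x ∷ y ∷ v) = ⌊ y ℤ.<? x ⌋ ∷ desBits (y ∷ v)

-- The next letter y is below x exactly when at least as many elements of W lie above it, and
-- deleting y from W does not change how many lie above y. So the ranks obey the recursion of
-- `∑-orderings`.
∑-arrangements-after : ∀ m {W} x F → Unique W → length W ≡ m → x ∉ W →
                       ∑-arrangements W m (λ v → F (desBits (x ∷ v))) ≡ ∑-orderings m (above W x) F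
∑-arrangements-after zero    x F uniq len x∉ = trans (+-identityʳ _) (+-identityʳ _)
∑-arrangements-after (suc m) {W} x F uniq len x∉ = begin
  ∑-arrangements W (suc m) (λ v → F (desBits (x ∷ v)))
    ≡⟨ ∑-arrangements-suc W m _ ⟩
  ∑[ y ∈ W ] ∑-arrangements (without y W) m (λ v → F (⌊ y ℤ.<? x ⌋ ∷ desBits (y ∷ v)))
    ≡⟨ ∑-cong-∈ W step ⟩
  ∑[ y ∈ W ] ∑-orderings m (above W y) (λ D → F ((above W x ≤ᵇ above W y) ∷ D))
    ≡⟨ ∑-above uniq (λ j → ∑-orderings m j (λ D → F ((above W x ≤ᵇ j) ∷ D))) ⟩
  ∑[ j ∈ upTo (length W) ] ∑-orderings m j (λ D → F ((above W x ≤ᵇ j) ∷ D))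
    ≡⟨ cong (λ l → ∑[ j ∈ upTo l ] ∑-orderings m j (λ D → F ((above W x ≤ᵇ j) ∷ D))) len ⟩
  ∑-orderings (suc m) (above W x) F ∎
  where
  step : ∀ {y} → y ∈ W → ∑-arrangements (without y W) m (λ v → F (⌊ y ℤ.<? x ⌋ ∷ desBits (y ∷ v)))
                       ≡ ∑-orderings m (above W y) (λ D → F ((above W x ≤ᵇ above W y) ∷ D))
  step {y} y∈ = begin
    ∑-arrangements (without y W) m (λ v → F (⌊ y ℤ.<? x ⌋ ∷ desBits (y ∷ v)))
      ≡⟨ ∑-arrangements-after m y (λ D → F (⌊ y ℤ.<? x ⌋ ∷ D)) (Uniqueₚ.filter⁺ _ uniq)
           (suc-injective (trans (length-without uniq y∈) len))
           (λ y∈′ → proj₂ (∈-filter⁻ (λ z → ¬? (y ℤ.≟ z)) {xs = W} y∈′) refl) ⟩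
    ∑-orderings m (above (without y W) y) (λ D → F (⌊ y ℤ.<? x ⌋ ∷ D))
      ≡⟨ cong₂ (λ j b → ∑-orderings m j (λ D → F (b ∷ D))) (above-without W y)
               (sym (above-≤ᵇ W y∈ (λ { refl → x∉ y∈ }))) ⟩
    ∑-orderings m (above W y) (λ D → F ((above W x ≤ᵇ above W y) ∷ D)) ∎

∑-arrangements-desBits : ∀ m {W} F → Unique W → length W ≡ suc m →
                         ∑-arrangements W (suc m) (F ∘ desBits) ≡ ∑[ j ∈ upTo (suc m) ] ∑-orderings m j F
∑-arrangements-desBits m {W} F uniq len = begin
  ∑-arrangements W (suc m) (F ∘ desBits)
    ≡⟨ ∑-arrangements-suc W m _ ⟩
  ∑[ y ∈ W ] ∑-arrangements (without y W) m (λ v → F (desBits (y ∷ v)))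
    ≡⟨ ∑-cong-∈ W (λ {y} y∈ → trans
         (∑-arrangements-after m y F (Uniqueₚ.filter⁺ _ uniq) (suc-injective (trans (length-without uniq y∈) len))
           (λ y∈′ → proj₂ (∈-filter⁻ (λ z → ¬? (y ℤ.≟ z)) {xs = W} y∈′) refl))
         (cong (λ j → ∑-orderings m j F) (above-without W y))) ⟩
  ∑[ y ∈ W ] ∑-orderings m (above W y) F
    ≡⟨ ∑-above uniq (λ j → ∑-orderings m j F) ⟩
  ∑[ j ∈ upTo (length W) ] ∑-orderings m j F
    ≡⟨ cong (λ l → ∑[ j ∈ upTo l ] ∑-orderings m j F) len ⟩
  ∑[ j ∈ upTo (suc m) ] ∑-orderings m j F ∎

-- Signed permutations with a prescribed set of negated values

isNeg : ℤ → Bool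
isNeg z = ⌊ z ℤ.<? ℤ.+ 0 ⌋

-- For σ in Bₙ, the bit at index k tells whether -(k + 1), rather than k + 1, is a value of σ.
negBits : Vec ℤ n → Vec Bool n
negBits σ = Vec.map isNeg (inverse σ)

bit : Vec Bool n → ℕ → Bool
bit []      _       = false
bit (b ∷ _) zero    = b
bit (_ ∷ S) (suc k) = bit S k

bit-lookup : ∀ (S : Vec Bool n) i → bit S (toℕ i) ≡ Vec.lookup S i
bit-lookup (_ ∷ _) Fin.zero    = refl
bit-lookup (_ ∷ S) (Fin.suc i) = bit-lookup S i

signed : Bool → ℕ → ℤ
signed true  k = -[1+ k ]
signed false k = ℤ.+ suc k

-- Of each pair ±(k + 1) exactly one passes. Past the length of S the default of `bit` admits the
-- positive one; intersecting with `signedVals n` removes it.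
hasSign : Vec Bool n → ℤ → Bool
hasSign S (ℤ.+ zero)  = false
hasSign S (ℤ.+ suc k) = not (bit S k)
hasSign S -[1+ k ]    = bit S k

hasSign? : (S : Vec Bool n) → Decidable (T ∘ hasSign S)
hasSign? S z = T? (hasSign S z)

isNeg-signed : ∀ b k → isNeg (signed b k) ≡ b
isNeg-signed true  k = refl
isNeg-signed false k = refl

∣signed∣ : ∀ b k → ∣ signed b k ∣ ≡ suc k
∣signed∣ true  k = refl
∣signed∣ false k = refl

hasSign-signed : ∀ (S : Vec Bool n) b k → bit S k ≡ b → T (hasSign S (signed b k))
hasSign-signed S true  k eq = subst T (sym eq) _
hasSign-signed S false k eq = subst (T ∘ not) (sym eq) _

hasSign⇒signed : ∀ (S : Vec Bool n) z → T (hasSign S z) → ∃ λ k → z ≡ signed (bit S k) k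
hasSign⇒signed S (ℤ.+ suc k) t with bit S k in eq
... | false = k , cong (λ b → signed b k) (sym eq)
hasSign⇒signed S -[1+ k ] t with bit S k in eq
... | true  = k , cong (λ b → signed b k) (sym eq)

hasSign-injective : ∀ (S : Vec Bool n) {y z} → T (hasSign S y) → T (hasSign S z) → ∣ y ∣ ≡ ∣ z ∣ → y ≡ z
hasSign-injective S {y} {z} ty tz eq with hasSign⇒signed S y ty | hasSign⇒signed S z tz
... | k , refl | l , refl with suc-injective (trans (sym (∣signed∣ (bit S k) k)) (trans eq (∣signed∣ (bit S l) l)))
... | refl = refl

∈-signedVals⁺ : ∀ {n k} b → k < n → signed b k ∈ signedVals n
∈-signedVals⁺ {n} true  k<n = ∈-++⁺ʳ (map (λ k → ℤ.+ suc k) (upTo n)) (∈-map⁺ -[1+_] (∈-upTo⁺ k<n))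
∈-signedVals⁺     false k<n = ∈-++⁺ˡ (∈-map⁺ (λ k → ℤ.+ suc k) (∈-upTo⁺ k<n))

∈-signedVals⁻ : ∀ {n z} → z ∈ signedVals n → ∃ λ b → ∃ λ k → k < n × z ≡ signed b k
∈-signedVals⁻ {n} z∈ with ∈-++⁻ (map (λ k → ℤ.+ suc k) (upTo n)) z∈
... | inj₁ z∈ˡ with ∈-map⁻ (λ k → ℤ.+ suc k) z∈ˡ
...   | k , k∈ , refl = false , k , ∈-upTo⁻ k∈ , refl
∈-signedVals⁻ {n} z∈ | inj₂ z∈ʳ with ∈-map⁻ -[1+_] z∈ʳ
...   | k , k∈ , refl = true , k , ∈-upTo⁻ k∈ , refl

signedVals-unique : ∀ n → Unique (signedVals n)
signedVals-unique n = Uniqueₚ.++⁺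
  (Uniqueₚ.map⁺ (suc-injective ∘ ℤₚ.+-injective) (Uniqueₚ.upTo⁺ n))
  (Uniqueₚ.map⁺ ℤₚ.-[1+-injective (Uniqueₚ.upTo⁺ n))
  disjoint
  where
  disjoint : ∀ {z} → ¬ (z ∈ map (λ k → ℤ.+ suc k) (upTo n) × z ∈ map -[1+_] (upTo n))
  disjoint (p , q) with ∈-map⁻ (λ k → ℤ.+ suc k) p | ∈-map⁻ -[1+_] q
  ... | k , _ , refl | l , _ , ()

valuesWith : Vec Bool n → List ℤ
valuesWith {n} S = filter (hasSign? S) (signedVals n)

length-valuesWith : ∀ (S : Vec Bool n) → length (valuesWith S) ≡ n
length-valuesWith {n} S = begin
  length (valuesWith S)
    ≡⟨ length-filter (hasSign? S) (signedVals n) ⟩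
  ∑[ z ∈ signedVals n ] ⟦ hasSign S z ⟧
    ≡⟨ ∑-++ (map (λ k → ℤ.+ suc k) (upTo n)) _ _ ⟩
  ∑ (map (λ k → ℤ.+ suc k) (upTo n)) (⟦_⟧ ∘ hasSign S) + ∑ (map -[1+_] (upTo n)) (⟦_⟧ ∘ hasSign S)
    ≡⟨ cong₂ _+_ (∑-map (upTo n) (λ k → ℤ.+ suc k) (⟦_⟧ ∘ hasSign S)) (∑-map (upTo n) -[1+_] (⟦_⟧ ∘ hasSign S)) ⟩
  ∑[ k ∈ upTo n ] ⟦ not (bit S k) ⟧ + ∑[ k ∈ upTo n ] ⟦ bit S k ⟧
    ≡⟨ ∑-+ (upTo n) (λ k → ⟦ not (bit S k) ⟧) _ ⟨
  ∑[ k ∈ upTo n ] (⟦ not (bit S k) ⟧ + ⟦ bit S k ⟧)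
    ≡⟨ ∑-cong (upTo n) (λ k → complement (bit S k)) ⟩
  ∑[ k ∈ upTo n ] 1
    ≡⟨ trans (∑-const (upTo n) 1) (trans (*-identityʳ _) (length-upTo n)) ⟩
  n ∎
  where
  complement : ∀ b → ⟦ not b ⟧ + ⟦ b ⟧ ≡ 1
  complement true  = refl
  complement false = refl

-- `invAt` transfers the sign of the letter to its position. The position is a successor, since at 0
-- a negative sign would be lost.
isNeg-invAt : ∀ {l} p {z} → Unique (map ∣_∣ l) → z ∈ l → isNeg (invAt l (suc p) ∣ z ∣) ≡ isNeg z
isNeg-invAt {y ∷ l} p {z} (y∉ ∷ uniq) z∈ with ∣ y ∣ ≡ᵇ ∣ z ∣ in eq | z∈
... | true  | there z∈l = contradiction (≡ᵇ⇒≡ ∣ y ∣ ∣ z ∣ (subst T (sym eq) _)) (All.lookup (Allₚ.map⁻ y∉) z∈l)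
... | false | there z∈l = isNeg-invAt (suc p) uniq z∈l
... | false | here refl = ⊥-elim (subst T eq (≡⇒≡ᵇ ∣ y ∣ ∣ y ∣ refl))
... | true  | here refl = sign y
  where
  sign : ∀ y → isNeg (signTimes y (suc p)) ≡ isNeg y
  sign (ℤ.+ _)  = refl
  sign -[1+ _ ] = refl

lookup-negBits : ∀ (σ : Vec ℤ n) i → Vec.lookup (negBits σ) i ≡ isNeg (invAt (toList σ) 1 (suc (toℕ i)))
lookup-negBits σ i =
  trans (lookup-map i isNeg (inverse σ)) (cong isNeg (lookup∘tabulate (λ j → invAt (toList σ) 1 (suc (toℕ j))) i))

lookup-extensional : ∀ {u v : Vec A n} → (∀ i → Vec.lookup u i ≡ Vec.lookup v i) → u ≡ v
lookup-extensional {u = u} {v} eq =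
  trans (sym (tabulate∘lookup u)) (trans (Vecₚ.tabulate-cong eq) (tabulate∘lookup v))

T-extensional : ∀ {a b} → (T a → T b) → (T b → T a) → a ≡ b
T-extensional {true}  {true}  to from = refl
T-extensional {false} {false} to from = refl
T-extensional {true}  {false} to from = ⊥-elim (to _)
T-extensional {false} {true}  to from = ⊥-elim (from _)

any-≡ᵇ⁻ : ∀ x r → T (not (any (x ≡ᵇ_) r)) → All (x ≢_) r
any-≡ᵇ⁻ x []      t = []
any-≡ᵇ⁻ x (y ∷ r) t with x ≡ᵇ y in eq
... | false = (λ { refl → subst T eq (≡⇒≡ᵇ x x refl) }) ∷ any-≡ᵇ⁻ x r t

any-≡ᵇ⁺ : ∀ {x r} → All (x ≢_) r → T (not (any (x ≡ᵇ_) r))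
any-≡ᵇ⁺ []                     = _
any-≡ᵇ⁺ {x} (_∷_ {x = y} x≢y x∉) with x ≡ᵇ y in eq
... | false = any-≡ᵇ⁺ x∉
... | true  = contradiction (≡ᵇ⇒≡ x y (subst T (sym eq) _)) x≢y

allDistinct⇒Unique : ∀ l → T (allDistinct l) → Unique l
allDistinct⇒Unique []      t = []
allDistinct⇒Unique (x ∷ l) t =
  let t₁ , t₂ = Equivalence.to Bool.T-∧ t in any-≡ᵇ⁻ x l t₁ ∷ allDistinct⇒Unique l t₂

Unique⇒allDistinct : ∀ {l} → Unique l → T (allDistinct l)
Unique⇒allDistinct []          = _
Unique⇒allDistinct (x∉ ∷ uniq) = Equivalence.from Bool.T-∧ (any-≡ᵇ⁺ x∉ , Unique⇒allDistinct uniq)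

∈-vecsOver⁻ : ∀ (V : List A) m {v : Vec A m} → v ∈ vecsOver V m → All (_∈ V) (toList v)
∈-vecsOver⁻ V zero    (here refl) = []
∈-vecsOver⁻ V (suc m) v∈ with ∈-concat⁻′ (map (λ x → map (x ∷_) (vecsOver V m)) V) v∈
... | l , v∈l , l∈ with ∈-map⁻ (λ x → map (x ∷_) (vecsOver V m)) l∈
... | x , x∈ , refl with ∈-map⁻ (x ∷_) v∈l
... | v , v∈V , refl = x∈ ∷ ∈-vecsOver⁻ V m v∈V

module _ (S : Vec Bool n) (σ : Vec ℤ n) (σ⊆ : All (_∈ signedVals n) (toList σ)) where

  private
    l = toList σ

  negBits⇒hasSign : Unique (map ∣_∣ l) → negBits σ ≡ S → All (T ∘ hasSign S) l
  negBits⇒hasSign uniq negs = All.tabulate sign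
    where
    sign : ∀ {z} → z ∈ l → T (hasSign S z)
    sign z∈ with ∈-signedVals⁻ (All.lookup σ⊆ z∈)
    ... | b , k , k<n , refl = hasSign-signed S b k (begin
      bit S k
        ≡⟨ cong (bit S) (toℕ-fromℕ< k<n) ⟨
      bit S (toℕ i)
        ≡⟨ bit-lookup S i ⟩
      Vec.lookup S i
        ≡⟨ cong (λ u → Vec.lookup u i) negs ⟨
      Vec.lookup (negBits σ) i
        ≡⟨ lookup-negBits σ i ⟩
      isNeg (invAt l 1 (suc (toℕ i)))
        ≡⟨ cong (isNeg ∘ invAt l 1) (trans (cong suc (toℕ-fromℕ< k<n)) (sym (∣signed∣ b k))) ⟩
      isNeg (invAt l 1 ∣ signed b k ∣)
        ≡⟨ isNeg-invAt 0 uniq z∈ ⟩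
      isNeg (signed b k)
        ≡⟨ isNeg-signed b k ⟩
      b ∎)
      where i = fromℕ< k<n

  hasSign⇒distinct : All (T ∘ hasSign S) l → Unique l → Unique (map ∣_∣ l)
  hasSign⇒distinct signs =
    unique-map ∣_∣ (λ y∈ z∈ → hasSign-injective S (All.lookup signs y∈) (All.lookup signs z∈))

  hasSign⇒negBits : All (T ∘ hasSign S) l → Unique l → negBits σ ≡ S
  hasSign⇒negBits signs uniq = lookup-extensional λ i →
    let k = toℕ i ; b = bit S k in begin
    Vec.lookup (negBits σ) i
      ≡⟨ lookup-negBits σ i ⟩
    isNeg (invAt l 1 (suc k))
      ≡⟨ cong (isNeg ∘ invAt l 1) (∣signed∣ b k) ⟨
    isNeg (invAt l 1 ∣ signed b k ∣)
      ≡⟨ isNeg-invAt 0 (hasSign⇒distinct signs uniq)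
           (∈-resp-↭ (↭-sym l↭) (∈-filter⁺ (hasSign? S) (∈-signedVals⁺ b (toℕ<n i)) (hasSign-signed S b k refl))) ⟩
    isNeg (signed b k)
      ≡⟨ isNeg-signed b k ⟩
    b
      ≡⟨ bit-lookup S i ⟩
    Vec.lookup S i ∎
    where
    -- By cardinality, a word on distinct values uses every available value.
    l↭ : l ↭ valuesWith S
    l↭ = unique-⊆⇒↭ uniq (λ z∈ → ∈-filter⁺ (hasSign? S) (All.lookup σ⊆ z∈) (All.lookup signs z∈))
           (≤-reflexive (trans (length-valuesWith S) (sym (length-toList σ))))

  -- S admits one sign per absolute value, so distinct letters have distinct absolute values.
  -- Conversely the inverse reveals the sign of every letter that occurs.
  distinct∧negBits : allDistinct (map ∣_∣ l) ∧ does (negBits σ ≟ᵥ S) ≡ does (all? (hasSign? S) l) ∧ does (unique? l)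
  distinct∧negBits = T-extensional to from
    where
    T-does : ∀ {P : Set} (P? : Dec P) → T (does P?) → P
    T-does (yes p) _ = p

    does-T : ∀ {P : Set} (P? : Dec P) → P → T (does P?)
    does-T P? p = subst T (sym (dec-true P? p)) _

    to : T (allDistinct (map ∣_∣ l) ∧ does (negBits σ ≟ᵥ S)) → T (does (all? (hasSign? S) l) ∧ does (unique? l))
    to t = let t₁ , t₂ = Equivalence.to Bool.T-∧ t ; uniq = allDistinct⇒Unique (map ∣_∣ l) t₁ in
      Equivalence.from Bool.T-∧
        ( does-T (all? (hasSign? S) l) (negBits⇒hasSign uniq (T-does (negBits σ ≟ᵥ S) t₂))
        , does-T (unique? l) (Uniqueₚ.map⁻ uniq))

    from : T (does (all? (hasSign? S) l) ∧ does (unique? l)) → T (allDistinct (map ∣_∣ l) ∧ does (negBits σ ≟ᵥ S))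
    from t = let t₁ , t₂ = Equivalence.to Bool.T-∧ t ; signs = T-does (all? (hasSign? S) l) t₁ ; uniq = T-does (unique? l) t₂ in
      Equivalence.from Bool.T-∧
        ( Unique⇒allDistinct (hasSign⇒distinct signs uniq)
        , does-T (negBits σ ≟ᵥ S) (hasSign⇒negBits signs uniq))

∑-Bn : ∀ n (F : Vec Bool n → Vec Bool n → ℕ) →
       ∑[ σ ∈ Bn n ] F (desBits σ) (negBits σ)
         ≡ ∑[ S ∈ boolVecs n ] ∑-arrangements (valuesWith S) n (λ σ → F (desBits σ) S)
∑-Bn n F = begin
  ∑[ σ ∈ Bn n ] F (desBits σ) (negBits σ)
    ≡⟨ ∑-filterᵇ (λ σ → dist σ) V _ ⟩
  ∑[ σ ∈ V ] (⟦ dist σ ⟧ * F (desBits σ) (negBits σ))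
    -- Inserting a sum over all S of the indicator of `negBits σ` = S turns the sign vector into a
    -- free variable.
    ≡⟨ ∑-cong V (λ σ → trans (cong (⟦ dist σ ⟧ *_) (sym (∑-boolVecs-single (negBits σ) (F (desBits σ)))))
                             (sym (∑-*ˡ (boolVecs n) ⟦ dist σ ⟧ (λ S → ⟦ does (negBits σ ≟ᵥ S) ⟧ * F (desBits σ) S)))) ⟩
  ∑[ σ ∈ V ] ∑[ S ∈ boolVecs n ] (⟦ dist σ ⟧ * (⟦ does (negBits σ ≟ᵥ S) ⟧ * F (desBits σ) S))
    ≡⟨ ∑-swap V (boolVecs n) _ ⟩
  ∑[ S ∈ boolVecs n ] ∑[ σ ∈ V ] (⟦ dist σ ⟧ * (⟦ does (negBits σ ≟ᵥ S) ⟧ * F (desBits σ) S))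
    ≡⟨ ∑-cong (boolVecs n) (λ S → trans (∑-cong-∈ V (λ {σ} σ∈ → regroup S σ σ∈))
         (∑-vecsOver-all (hasSign? S) (signedVals n) n (λ σ → ⟦ does (unique? (toList σ)) ⟧ * F (desBits σ) S))) ⟩
  ∑[ S ∈ boolVecs n ] ∑-arrangements (valuesWith S) n (λ σ → F (desBits σ) S) ∎
  where
  V = vecsOver (signedVals n) n
  dist : Vec ℤ n → Bool
  dist σ = allDistinct (map ∣_∣ (toList σ))

  ⟦∧⟧-* : ∀ a b c → ⟦ a ∧ b ⟧ * c ≡ ⟦ a ⟧ * (⟦ b ⟧ * c)
  ⟦∧⟧-* a b c = trans (cong (_* c) (⟦∧⟧ a b)) (*-assoc ⟦ a ⟧ ⟦ b ⟧ c)

  regroup : ∀ S σ → σ ∈ V → ⟦ dist σ ⟧ * (⟦ does (negBits σ ≟ᵥ S) ⟧ * F (desBits σ) S)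
            ≡ ⟦ does (all? (hasSign? S) (toList σ)) ⟧ * (⟦ does (unique? (toList σ)) ⟧ * F (desBits σ) S)
  regroup S σ σ∈ = begin
    ⟦ dist σ ⟧ * (⟦ does (negBits σ ≟ᵥ S) ⟧ * F (desBits σ) S)
      ≡⟨ ⟦∧⟧-* (dist σ) _ _ ⟨
    ⟦ dist σ ∧ does (negBits σ ≟ᵥ S) ⟧ * F (desBits σ) S
      ≡⟨ cong (λ b → ⟦ b ⟧ * F (desBits σ) S) (distinct∧negBits S σ (∈-vecsOver⁻ (signedVals n) n σ∈)) ⟩
    ⟦ does (all? (hasSign? S) (toList σ)) ∧ does (unique? (toList σ)) ⟧ * F (desBits σ) S
      ≡⟨ ⟦∧⟧-* (does (all? (hasSign? S) (toList σ))) _ _ ⟩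
    ⟦ does (all? (hasSign? S) (toList σ)) ⟧ * (⟦ does (unique? (toList σ)) ⟧ * F (desBits σ) S) ∎

-- The exponent of a signed permutation in difference coordinates

positions : Vec Bool n → ℕ → List ℕ
positions []          s = []
positions (true ∷ b)  s = s ∷ positions b (suc s)
positions (false ∷ b) s = positions b (suc s)

if-positions : ∀ b (D : Vec Bool n) s {l} → l ≡ positions D (suc s) → (if b then s ∷ l else l) ≡ positions (b ∷ D) s
if-positions true  D s eq = cong (s ∷_) eq
if-positions false D s eq = eq

desFrom-positions : ∀ (v : Vec ℤ n) s → desFrom (toList v) s ≡ positions (desBits v) s
desFrom-positions []          s = refl
desFrom-positions (x ∷ [])    s = refl
desFrom-positions (x ∷ y ∷ v) s = if-positions _ (desBits (y ∷ v)) s (desFrom-positions (y ∷ v) (suc s))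

negFrom-positions : ∀ (v : Vec ℤ n) s → negFrom (toList v) s ≡ positions (Vec.map isNeg v) s
negFrom-positions []      s = refl
negFrom-positions (x ∷ v) s = if-positions _ (Vec.map isNeg v) s (negFrom-positions v (suc s))

countGe-∷ : ∀ i j l → countGe i (j ∷ l) ≡ ⟦ i ≤ᵇ j ⟧ + countGe i l
countGe-∷ i j l with i ≤ᵇ j
... | true  = refl
... | false = refl

countGe-all : ∀ (b : Vec Bool n) {i s} → i ≤ s → countGe i (positions b s) ≡ total (bits b)
countGe-all []          i≤s = refl
countGe-all (true ∷ b) {i} {s} i≤s =
  trans (countGe-∷ i s (positions b (suc s)))
        (cong₂ _+_ (cong ⟦_⟧ (≤⇒≤ᵇ-true i≤s)) (countGe-all b (m≤n⇒m≤1+n i≤s)))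
countGe-all (false ∷ b) i≤s = countGe-all b (m≤n⇒m≤1+n i≤s)

countGe-later : ∀ c (b : Vec Bool n) {i s} → s < i → countGe i (positions (c ∷ b) s) ≡ countGe i (positions b (suc s))
countGe-later true  b {i} {s} s<i =
  trans (countGe-∷ i s (positions b (suc s))) (cong (λ z → ⟦ z ⟧ + countGe i (positions b (suc s))) (>⇒≤ᵇ-false s<i))
countGe-later false b s<i = refl

-- Counting the marked positions from i onwards gives the tail sums of the indicator vector; s is
-- the position of its first entry.
tabulate-countGe : ∀ (b : Vec Bool n) s → tabulate (λ i → countGe (s + toℕ i) (positions b s)) ≡ suf (bits b)
tabulate-countGe []      s = refl
tabulate-countGe (c ∷ b) s = cong₂ _∷_
  (countGe-all (c ∷ b) (≤-reflexive (+-identityʳ s)))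
  (trans (Vecₚ.tabulate-cong (λ i → trans (countGe-later c b (m<m+n s z<s))
                                          (cong (λ j → countGe j (positions b (suc s))) (+-suc s (toℕ i)))))
         (tabulate-countGe b (suc s)))

tabulate-⊕ : ∀ (f g : Fin n → ℕ) → tabulate (λ i → f i + g i) ≡ tabulate f ⊕ tabulate g
tabulate-⊕ {zero}  f g = refl
tabulate-⊕ {suc n} f g = cong (f Fin.zero + g Fin.zero ∷_) (tabulate-⊕ (f ∘ Fin.suc) (g ∘ Fin.suc))

sigmaExp-suf : ∀ (σ : Vec ℤ n) → sigmaExp σ ≡ suf (bits (desBits σ) ⊕ bits (negBits σ))
sigmaExp-suf σ = begin
  sigmaExp σ
    ≡⟨ tabulate-⊕ (λ i → d σ (suc (toℕ i))) _ ⟩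
  tabulate (λ i → countGe (suc (toℕ i)) (desFrom (toList σ) 1))
    ⊕ tabulate (λ i → countGe (suc (toℕ i)) (negFrom (toList (inverse σ)) 1))
    ≡⟨ cong₂ (λ p q → tabulate (λ i → countGe (suc (toℕ i)) p) ⊕ tabulate (λ i → countGe (suc (toℕ i)) q))
             (desFrom-positions σ 1) (negFrom-positions (inverse σ) 1) ⟩
  tabulate (λ i → countGe (suc (toℕ i)) (positions (desBits σ) 1))
    ⊕ tabulate (λ i → countGe (suc (toℕ i)) (positions (negBits σ) 1))
    ≡⟨ cong₂ _⊕_ (tabulate-countGe (desBits σ) 1) (tabulate-countGe (negBits σ) 1) ⟩
  suf (bits (desBits σ)) ⊕ suf (bits (negBits σ))
    ≡⟨ suf-⊕ (bits (desBits σ)) (bits (negBits σ)) ⟨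
  suf (bits (desBits σ) ⊕ bits (negBits σ)) ∎

-- Comparison of coefficients

weaklyDecreasing-suf : ∀ (c : Exp n) → weaklyDecreasing (parts c) ≡ true
weaklyDecreasing-suf []           = refl
weaklyDecreasing-suf (x ∷ [])     = refl
weaklyDecreasing-suf (x ∷ y ∷ cs) =
  cong₂ _∧_ (≤⇒≤ᵇ-true (m≤n+m (y + total cs) x)) (weaklyDecreasing-suf (y ∷ cs))

total-suf : ∀ x {a : Exp n} (c : Exp (suc n)) → suf c ≡ x ∷ a → total c ≡ x
total-suf x (c ∷ cs) eq = cong Vec.head eq

differences : ∀ (a : Exp n) → T (weaklyDecreasing (toList a)) → ∃ λ c → suf c ≡ a
differences []          t = [] , refl
differences (x ∷ [])    t = x ∷ [] , cong (_∷ []) (+-identityʳ x)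
differences (x ∷ y ∷ a) t =
  let y≤x , t′ = Equivalence.to Bool.T-∧ t
      c , eq   = differences (y ∷ a) t′
  in x ∸ y ∷ c , cong₂ _∷_ (trans (cong (x ∸ y +_) (total-suf y c eq)) (m∸n+n≡m (≤ᵇ⇒≤ y x y≤x))) eq

rhs-suf : ∀ m (c : Exp (suc m)) → rhs (suc m) (suf c) ≡ ℤ.+ multinomial (multiplicities (parts c))
rhs-suf m c = begin
  rhs (suc m) (suf c)
    ≡⟨ rhs-suf-count (suc m) (suf c) ⟩
  ℤ.+ (∑[ σ ∈ Bn (suc m) ] spread N (map suf (units₂ (suc m))) (λ x → δ x (suf c)) (sigmaExp σ))
    ≡⟨ cong ℤ.+_ (begin
  ∑[ σ ∈ Bn (suc m) ] spread N (map suf (units₂ (suc m))) (λ x → δ x (suf c)) (sigmaExp σ)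
    ≡⟨ ∑-cong (Bn (suc m)) (λ σ → trans
         (cong (spread N (map suf (units₂ (suc m))) (λ x → δ x (suf c))) (sigmaExp-suf σ))
         (trans (spread-suf N (units₂ (suc m)) {λ x → δ x (suf c)} (λ x → δ-suf x c) _) (spread-units₂ N c _))) ⟩
  ∑[ σ ∈ Bn (suc m) ] F (desBits σ) (negBits σ)
    ≡⟨ ∑-Bn (suc m) F ⟩
  ∑[ S ∈ boolVecs (suc m) ] ∑-arrangements (valuesWith S) (suc m) (λ σ → F (desBits σ) S)
    ≡⟨ ∑-cong (boolVecs (suc m)) (λ S → ∑-arrangements-desBits m (λ D → F D S)
         (Uniqueₚ.filter⁺ (hasSign? S) (signedVals-unique (suc m))) (length-valuesWith S)) ⟩
  ∑[ S ∈ boolVecs (suc m) ] ∑[ j ∈ upTo (suc m) ] ∑-orderings m j (λ D → F D S)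
    -- The orderings are now indexed independently of S, so the signs can be summed for a fixed
    -- descent vector.
    ≡⟨ ∑-swap (boolVecs (suc m)) (upTo (suc m)) _ ⟩
  ∑[ j ∈ upTo (suc m) ] ∑[ S ∈ boolVecs (suc m) ] ∑-orderings m j (λ D → F D S)
    ≡⟨ ∑-cong (upTo (suc m)) (λ j → trans
         (∑-orderings-∑ m j (boolVecs (suc m)) (λ S D → F D S))
         (∑-orderings-cong m j (λ D → ∑-signs-weight D c (total≤total-suf c)))) ⟩
  ∑[ j ∈ upTo (suc m) ] ∑-orderings m j (λ D → allowed D c)
    ≡⟨ ∑-orderings-allowed (suc m) c ≤-refl ⟩
  (suc m C top c) * residual c
    ≡⟨ multinomial-multiplicities-suf c ⟨
  multinomial (multiplicities (parts c)) ∎) ⟩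
  ℤ.+ multinomial (multiplicities (parts c)) ∎
  where
  N = total (suf c)
  F : Vec Bool (suc m) → Vec Bool (suc m) → ℕ
  F D S = weight N (bits D ⊕ bits S) c

-- Every exponent on the right has the form `suf x`, and tail sums of naturals decrease weakly.
rhs-non-partition : ∀ (a : Exp n) → weaklyDecreasing (toList a) ≡ false → rhs n a ≡ ℤ.+ 0
rhs-non-partition {n} a ¬dec =
  trans (rhs-suf-count n a) (cong ℤ.+_ (trans (∑-cong (Bn n) vanishes) (∑-zero (Bn n))))
  where
  suf≢a : ∀ x → suf x ≢ a
  suf≢a x refl with () ← trans (sym (weaklyDecreasing-suf x)) ¬dec

  vanishes : ∀ σ → spread (total a) (map suf (units₂ n)) (λ x → δ x a) (sigmaExp σ) ≡ 0
  vanishes σ = begin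
    spread (total a) (map suf (units₂ n)) (λ x → δ x a) (sigmaExp σ)
      ≡⟨ cong (spread (total a) (map suf (units₂ n)) (λ x → δ x a)) (sigmaExp-suf σ) ⟩
    spread (total a) (map suf (units₂ n)) (λ x → δ x a) (suf (bits (desBits σ) ⊕ bits (negBits σ)))
      ≡⟨ spread-suf (total a) (units₂ n) {ψ = λ _ → 0} (λ x → δ-≢ (suf≢a x)) _ ⟩
    spread (total a) (units₂ n) (λ _ → 0) (bits (desBits σ) ⊕ bits (negBits σ))
      -- The zero function is 0 times itself, so the factor 0 comes out of the whole sum.
      ≡⟨ spread-* (total a) (units₂ n) 0 {ψ = λ _ → 0} (λ _ → refl) _ ⟩
    0 ∎

theorem6p7 : (n : ℕ) → 0 < n → (a : Exp n) → lhs n a ≡ rhs n a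
theorem6p7 (suc m) _ a with weaklyDecreasing (toList a) in eq
... | false = sym (rhs-non-partition a eq)
... | true with differences a (subst T (sym eq) _)
... | c , refl = sym (rhs-suf m c)
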